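{- Let $G$ be a finite simple graph on the vertex set $[d]=\{1,\ldots,d\}$ with no isolated vertices, and let $\mathcal{P}(G)=2\cdot\mathrm{FRAC}(G)$. Then there exist polynomials $a(t)$ of degree $d-1$ and $b(t)$ of degree $d-2$, each with symmetric and unimodal coefficient sequence, such that $\delta(\mathcal{P}(G),t)=a(t)+t\,b(t)$. In particular, the $\delta$-vector $(\delta_0,\delta_1,\ldots,\delta_{d-1})$ of $\mathcal{P}(G)$ is alternatingly increasing, i.e. $$\delta_0\le\delta_{d-1}\le\delta_1\le\delta_{d-2}\le\cdots\le\delta_{\lfloor d/2\rfloor-1}\le\delta_{d-\lfloor d/2\rfloor}\le\delta_{\lfloor d/2\rfloor}.$$
   Context: For a finite simple graph $G$ on $[d]$ with edge set $E(G)$, the fractional stable set polytope is $\mathrm{FRAC}(G)=\{(x_1,\ldots,x_d)\in\mathbb{R}^d : x_i\ge 0\ (1\le i\le d),\ x_i+x_j\le 1\ ((i,j)\in E(G))\}$; its vertices lie in $\{0,1/2,1\}^d$, so $\mathcal{P}(G)=2\,\mathrm{FRAC}(G)$ is a $d$-dimensional lattice polytope. For a $d$-dimensional lattice polytope $P\subset\mathbb{R}^d$, its Ehrhart series is $1+\sum_{n\ge1}\#(nP\cap\mathbb{Z}^d)t^n=\delta(P,t)/(1-t)^{d+1}$ with $\delta(P,t)$ a polynomial (the $\delta$-polynomial); its coefficient list is the $\delta$-vector. A polynomial $c_0+c_1t+\cdots+c_mt^m$ of degree $m$ is symmetric if $c_i=c_{m-i}$ for all $i$, and unimodal if $c_0\le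 c_1\le\cdots\le c_k\ge c_{k+1}\ge\cdots\ge c_m$ for some $k$. -}

module Defs where

open import Data.Bool using (Bool; true; false; not; _∨_; _∧_)
open import Data.Nat using (ℕ; zero; suc; _+_; _*_; _∸_; _≤ᵇ_; _<_; _≤_; _/_)
open import Data.Nat.Combinatorics using (_C_)
open import Data.Fin using (Fin)
open import Data.Vec using (Vec; []; _∷_; lookup)
open import Data.List using (List; []; _∷_; map; concatMap; filter; length; upTo; allFin)
open import Data.Bool.ListAction using (all)
open import Data.Integer as ℤ using (ℤ; +_; -_)
open import Data.Product using (Σ; ∃; _×_; _,_)
open import Relation.Binary.PropositionalEquality using (_≡_; _≢_)
open import Relation.Nullary.Decidable using (T?)

record SimpleGraph (d : ℕ) : Set where
  field
    adj     : Fin d → Fin d → Bool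
    symm    : ∀ i j → adj i j ≡ adj j i
    irrefl  : ∀ i → adj i i ≡ false

open SimpleGraph public

NoIsolated : ∀ {d} → SimpleGraph d → Set
NoIsolated {d} G = ∀ (i : Fin d) → ∃ λ (j : Fin d) → adj G i j ≡ true

box : ℕ → (d : ℕ) → List (Vec ℕ d)
box m zero    = [] ∷ []
box m (suc d) = concatMap (λ a → map (a ∷_) (box m d)) (upTo (suc m))

-- x ∈ n·P(G) = 2n·FRAC(G), for x ∈ ℕ^d (x_i ≥ 0 is automatic):
-- x_i + x_j ≤ 2n for every edge (i,j).
inNP : ∀ {d} → SimpleGraph d → ℕ → Vec ℕ d → Bool
inNP {d} G n x =
  all (λ i → all (λ j → not (adj G i j) ∨ ((lookup x i + lookup x j) ≤ᵇ (2 * n)))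
                 (allFin d))
      (allFin d)

-- Ehrhart function L(n) = #(n·P(G) ∩ ℤ^d).  When G has no isolated
-- vertices every lattice point of n·P(G) satisfies 0 ≤ x_i ≤ 2n, so the
-- enumeration over the box {0,…,2n}^d is exhaustive.  (L 0 = 1.)
ehrhart : ∀ {d} → SimpleGraph d → ℕ → ℕ
ehrhart {d} G n = length (filter (λ x → T? (inNP G n x)) (box (2 * n) d))

negPow : ℕ → ℤ
negPow zero    = + 1
negPow (suc j) = - negPow j

sumTo : (ℕ → ℤ) → ℕ → ℤ
sumTo f zero    = f zero
sumTo f (suc k) = sumTo f k ℤ.+ f (suc k)

-- δ-polynomial coefficients: δ(t) = (1-t)^{d+1} · (Σ_{n≥0} L(n) t^n),
-- i.e. δ_k = Σ_{j=0}^{k} (-1)^j C(d+1,j) L(k-j).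
delta : ∀ {d} → SimpleGraph d → ℕ → ℤ
delta {d} G k = sumTo (λ j → negPow j ℤ.* (+ ((suc d) C j)) ℤ.* (+ ehrhart G (k ∸ j))) k

-- Polynomials are represented by coefficient functions ℕ → ℤ.
-- Degree exactly m:
HasDegree : (ℕ → ℤ) → ℕ → Set
HasDegree c m = (c m ≢ + 0) × (∀ i → m < i → c i ≡ + 0)

Symmetric : (ℕ → ℤ) → ℕ → Set
Symmetric c m = ∀ i → i ≤ m → c i ≡ c (m ∸ i)

Unimodal : (ℕ → ℤ) → ℕ → Set
Unimodal c m = Σ ℕ λ k → (k ≤ m) ×
  ((∀ i → i < k → c i ℤ.≤ c (suc i)) × (∀ i → k ≤ i → i < m → c (suc i) ℤ.≤ c i))

AltIncreasing : (ℕ → ℤ) → ℕ → Set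
AltIncreasing c d = ∀ i → suc i ≤ d / 2 →
  (c i ℤ.≤ c (d ∸ 1 ∸ i)) × (c (d ∸ 1 ∸ i) ℤ.≤ c (suc i))

timesT : (ℕ → ℤ) → ℕ → ℤ
timesT b zero    = + 0
timesT b (suc k) = b k

{-# OPTIONS --safe #-}

{-
Let E_U(n) be the number of x ∈ {0,…,2n}^U with x_i + x_j ≤ 2n along the edges
inside U.  A point is peeled by removing the set A where x is 0 and the set B
where x is 2n; the vertices of B have no neighbours outside A, every such pair
(A, B) occurs, and the other coordinates, lowered by 1, form a point counted by
E_R(n - 1).  Grouping consecutive low layers (sets A), and likewise consecutive
high layers (sets B), turns a point into an alternating sequence of runs.  A run
on p vertices contributes A_p(t)/(1 - t)^p, with A_p the Eulerian polynomial of
degree p - 1, and each high run contributes a further factor t.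

As G has no isolated vertices, the first run is low, so δ(t) is a sum of
products of Eulerian polynomials.  These are γ-positive, hence each product is
symmetric and unimodal.  With r runs its centre of symmetry is
(d - r)/2 + ⌊r/2⌋: this is (d - 1)/2 if the last run is low and d/2 if it is
high.  The two kinds of summands give a(t) and t b(t), and the alternating
inequalities follow by comparing coefficients.
-}
module Submission where

open import Defs
open import Data.Nat using (ℕ; suc; _∸_; _≤_)
open import Data.Integer using (ℤ; _+_)
open import Data.Product using (Σ; _×_)
open import Relation.Binary.PropositionalEquality using (_≡_)

open import Algebra.Bundles using (CommutativeRing; RawRing)
open import Algebra.Solver.Ring.AlmostCommutativeRing
  using (AlmostCommutativeRing; fromCommutativeRing; _-Raw-AlmostCommutative⟶_)
open import Data.Bool using (Bool; true; false; not; _∨_; T; if_then_else_)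
import Data.Bool.Properties as Boolₚ
open import Data.Bool.ListAction using (all)
open import Data.Empty using (⊥-elim)
open import Data.Fin using (Fin; zero; suc)
import Data.Fin.Properties as Finₚ
open import Data.Fin.Subset using (Subset; ⊤; ⊥) renaming (∣_∣ to size)
import Data.Fin.Subset.Properties as Subsetₚ
open import Data.Integer as ℤ using (+_; -_; _*_; 0ℤ; 1ℤ)
import Data.Integer.Properties as ℤₚ
open import Data.Integer.Tactic.RingSolver using (solve-∀)
open import Data.List using ([]; _∷_; map; concatMap; filter; length; applyUpTo; tabulate; _++_)
import Data.List.Properties as Listₚ
open import Data.Maybe using (Maybe; just; nothing)
open import Data.Nat as ℕ using (zero; _<_; z≤n; s≤s)
open import Data.Nat.Combinatorics using (k>n⇒nCk≡0; nCk+nC[k+1]≡[n+1]C[k+1])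
  renaming (_C_ to _choose_)
open import Data.Nat.DivMod using (m/n*n≤m)
import Data.Nat.Properties as ℕₚ
open import Data.Product using (∃; _,_; proj₁; proj₂)
open import Data.Sum using (inj₁; inj₂)
open import Data.Vec using (Vec; []; _∷_; lookup)
import Data.Vec.Properties as Vecₚ
open import Function using (_∘_; _⇔_; mk⇔)
open import Function.Bundles using (module Equivalence)
open import Level using (0ℓ)
open import Relation.Binary.PropositionalEquality
  using (refl; sym; trans; cong; cong₂; subst; subst₂; module ≡-Reasoning)
open import Relation.Nullary using (Dec; yes; no; does; ¬_)
open import Relation.Nullary.Decidable using (does-⇔; dec-true; dec-false; _×-dec_; _→-dec_; T?)
open import Relation.Unary using (Decidable)


-- Formal power series over ℤ

Series : Set
Series = ℕ → ℤ

infix 4 _≈_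
-- A record rather than a bare function type, so that `f` and `g` can be inferred from an equality.
record _≈_ (f g : Series) : Set where
  constructor pointwise
  field at : ∀ n → f n ≡ g n
open _≈_

infixl 6 _⊕_
infixl 7 _⊛_
infix 8 ⊖_

_⊕_ : Series → Series → Series
(f ⊕ g) n = f n + g n

⊖_ : Series → Series
(⊖ f) n = - f n

constant : ℤ → Series
constant c zero    = c
constant c (suc n) = 0ℤ

𝟎 𝟏 : Series
𝟎 = constant 0ℤ
𝟏 = constant 1ℤ

tail : Series → Series
tail f n = f (suc n)

scale : ℤ → Series → Series
scale c f n = c * f n

-- Cauchy product, recursive along `f = f 0 + t · tail f`. The tail of a product is then by
-- definition `scale (f 0) (tail g) ⊕ (tail f ⊛ g)`, on which associativity relies.
_⊛_ : Series → Series → Series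
(f ⊛ g) zero    = f 0 * g 0
(f ⊛ g) (suc n) = f 0 * g (suc n) + (tail f ⊛ g) n

≈-refl : ∀ {f} → f ≈ f
≈-refl = pointwise λ _ → refl

≈-sym : ∀ {f g} → f ≈ g → g ≈ f
≈-sym p = pointwise λ n → sym (at p n)

≈-trans : ∀ {f g h} → f ≈ g → g ≈ h → f ≈ h
≈-trans p q = pointwise λ n → trans (at p n) (at q n)

𝟎-at : ∀ n → 𝟎 n ≡ 0ℤ
𝟎-at zero    = refl
𝟎-at (suc n) = refl

⊛-cong-at : ∀ {f f′ g g′} → (∀ n → f n ≡ f′ n) → (∀ n → g n ≡ g′ n) →
  ∀ n → (f ⊛ g) n ≡ (f′ ⊛ g′) n
⊛-cong-at p q zero    = cong₂ _*_ (p 0) (q 0)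
⊛-cong-at p q (suc n) =
  cong₂ _+_ (cong₂ _*_ (p 0) (q (suc n))) (⊛-cong-at (λ m → p (suc m)) q n)

⊛-suc-right : ∀ f g n → (f ⊛ g) (suc n) ≡ (f ⊛ tail g) n + f (suc n) * g 0
⊛-suc-right f g zero    = refl
⊛-suc-right f g (suc n) =
  trans (cong (λ e → f 0 * g (suc (suc n)) + e) (⊛-suc-right (tail f) g n))
        (sym (ℤₚ.+-assoc (f 0 * g (suc (suc n))) ((tail f ⊛ tail g) n) _))

⊛-comm-at : ∀ f g n → (f ⊛ g) n ≡ (g ⊛ f) n
⊛-comm-at f g zero    = ℤₚ.*-comm (f 0) (g 0)
⊛-comm-at f g (suc n) = begin
  f 0 * g (suc n) + (tail f ⊛ g) n  ≡⟨ cong₂ _+_ (ℤₚ.*-comm (f 0) _) (⊛-comm-at (tail f) g n) ⟩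
  g (suc n) * f 0 + (g ⊛ tail f) n  ≡⟨ ℤₚ.+-comm (g (suc n) * f 0) _ ⟩
  (g ⊛ tail f) n + g (suc n) * f 0  ≡⟨ sym (⊛-suc-right g f n) ⟩
  (g ⊛ f) (suc n)                   ∎
  where open ≡-Reasoning

⊛-distribʳ-at : ∀ h f g n → ((f ⊕ g) ⊛ h) n ≡ (f ⊛ h) n + (g ⊛ h) n
⊛-distribʳ-at h f g zero    = ℤₚ.*-distribʳ-+ (h 0) (f 0) (g 0)
⊛-distribʳ-at h f g (suc n) =
  trans (cong (λ e → (f 0 + g 0) * h (suc n) + e) (⊛-distribʳ-at h (tail f) (tail g) n))
        (lemma (f 0) (g 0) (h (suc n)) _ _)
  where
  lemma : ∀ a b c x y → (a + b) * c + (x + y) ≡ (a * c + x) + (b * c + y)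
  lemma = solve-∀

scale-⊛ : ∀ c f g n → (scale c f ⊛ g) n ≡ c * (f ⊛ g) n
scale-⊛ c f g zero    = ℤₚ.*-assoc c (f 0) (g 0)
scale-⊛ c f g (suc n) =
  trans (cong (λ e → c * f 0 * g (suc n) + e) (scale-⊛ c (tail f) g n))
        (lemma c (f 0) (g (suc n)) _)
  where
  lemma : ∀ c a b x → c * a * b + c * x ≡ c * (a * b + x)
  lemma = solve-∀

⊛-assoc-at : ∀ f g h n → ((f ⊛ g) ⊛ h) n ≡ (f ⊛ (g ⊛ h)) n
⊛-assoc-at f g h zero    = ℤₚ.*-assoc (f 0) (g 0) (h 0)
⊛-assoc-at f g h (suc n) = begin
  f 0 * g 0 * h (suc n) + ((scale (f 0) (tail g) ⊕ (tail f ⊛ g)) ⊛ h) n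
    ≡⟨ cong (λ e → f 0 * g 0 * h (suc n) + e) (⊛-distribʳ-at h (scale (f 0) (tail g)) (tail f ⊛ g) n) ⟩
  f 0 * g 0 * h (suc n) + ((scale (f 0) (tail g) ⊛ h) n + ((tail f ⊛ g) ⊛ h) n)
    ≡⟨ cong₂ (λ x y → f 0 * g 0 * h (suc n) + (x + y)) (scale-⊛ (f 0) (tail g) h n) (⊛-assoc-at (tail f) g h n) ⟩
  f 0 * g 0 * h (suc n) + (f 0 * (tail g ⊛ h) n + (tail f ⊛ (g ⊛ h)) n)
    ≡⟨ lemma (f 0) (g 0) (h (suc n)) _ _ ⟩
  f 0 * (g 0 * h (suc n) + (tail g ⊛ h) n) + (tail f ⊛ (g ⊛ h)) n ∎
  where
  open ≡-Reasoning
  lemma : ∀ a b c x y → a * b * c + (a * x + y) ≡ a * (b * c + x) + y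
  lemma = solve-∀

⊛-zeroˡ-at : ∀ f n → (𝟎 ⊛ f) n ≡ 𝟎 n
⊛-zeroˡ-at f zero    = ℤₚ.*-zeroˡ (f 0)
⊛-zeroˡ-at f (suc n) = trans (cong₂ _+_ (ℤₚ.*-zeroˡ (f (suc n)))
  (trans (⊛-cong-at {g = f} (λ m → sym (𝟎-at m)) (λ _ → refl) n) (⊛-zeroˡ-at f n))) (trans (ℤₚ.+-identityˡ _) (𝟎-at n))

constant-⊛ : ∀ c f n → (constant c ⊛ f) n ≡ c * f n
constant-⊛ c f zero    = refl
constant-⊛ c f (suc n) =
  trans (cong (λ e → c * f (suc n) + e)
          (trans (⊛-cong-at {g = f} (λ m → sym (𝟎-at m)) (λ _ → refl) n)
                 (trans (⊛-zeroˡ-at f n) (𝟎-at n))))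
        (ℤₚ.+-identityʳ _)

⊛-identityˡ-at : ∀ f n → (𝟏 ⊛ f) n ≡ f n
⊛-identityˡ-at f n = trans (constant-⊛ 1ℤ f n) (ℤₚ.*-identityˡ (f n))

⊛-comm : ∀ f g → f ⊛ g ≈ g ⊛ f
⊛-comm f g = pointwise (⊛-comm-at f g)

⊛-distribʳ : ∀ h f g → (f ⊕ g) ⊛ h ≈ f ⊛ h ⊕ g ⊛ h
⊛-distribʳ h f g = pointwise (⊛-distribʳ-at h f g)

⊛-identityˡ : ∀ f → 𝟏 ⊛ f ≈ f
⊛-identityˡ f = pointwise (⊛-identityˡ-at f)

seriesRing : CommutativeRing 0ℓ 0ℓ
seriesRing = record
  { Carrier = Series ; _≈_ = _≈_ ; _+_ = _⊕_ ; _*_ = _⊛_ ; -_ = ⊖_ ; 0# = 𝟎 ; 1# = 𝟏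
  ; isCommutativeRing = record
    { isRing = record
      { +-isAbelianGroup = record
        { isGroup = record
          { isMonoid = record
            { isSemigroup = record
              { isMagma = record
                { isEquivalence = record { refl = ≈-refl ; sym = ≈-sym ; trans = ≈-trans }
                ; ∙-cong = λ p q → pointwise λ n → cong₂ _+_ (at p n) (at q n) }
              ; assoc = λ f g h → pointwise λ n → ℤₚ.+-assoc (f n) (g n) (h n) }
            ; identity = (λ f → pointwise λ n → trans (cong (λ e → e + f n) (𝟎-at n)) (ℤₚ.+-identityˡ (f n)))
                       , (λ f → pointwise λ n → trans (cong (λ e → f n + e) (𝟎-at n)) (ℤₚ.+-identityʳ (f n))) }
          ; inverse = (λ f → pointwise λ n → trans (ℤₚ.+-inverseˡ (f n)) (sym (𝟎-at n)))
                    , (λ f → pointwise λ n → trans (ℤₚ.+-inverseʳ (f n)) (sym (𝟎-at n)))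
          ; ⁻¹-cong = λ p → pointwise λ n → cong -_ (at p n) }
        ; comm = λ f g → pointwise λ n → ℤₚ.+-comm (f n) (g n) }
      ; *-cong = λ p q → pointwise (⊛-cong-at (at p) (at q))
      ; *-assoc = λ f g h → pointwise (⊛-assoc-at f g h)
      ; *-identity = ⊛-identityˡ , (λ f → ≈-trans (⊛-comm f 𝟏) (⊛-identityˡ f))
      ; distrib = (λ h f g → ≈-trans (⊛-comm h (f ⊕ g)) (≈-trans (⊛-distribʳ h f g)
                    (pointwise λ n → cong₂ _+_ (⊛-comm-at f h n) (⊛-comm-at g h n))))
                , ⊛-distribʳ }
    ; *-comm = ⊛-comm } }

module Ring = CommutativeRing seriesRing

seriesACR : AlmostCommutativeRing 0ℓ 0ℓ
seriesACR = fromCommutativeRing seriesRing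

ℤ-rawRing : RawRing 0ℓ 0ℓ
ℤ-rawRing = CommutativeRing.rawRing ℤₚ.+-*-commutativeRing

constant-homo : ℤ-rawRing -Raw-AlmostCommutative⟶ seriesACR
constant-homo = record
  { ⟦_⟧    = constant
  ; +-homo = λ x y → pointwise λ { zero → refl ; (suc n) → refl }
  ; *-homo = λ x y → pointwise λ { zero → refl ; (suc n) → sym (trans (constant-⊛ x (constant y) (suc n)) (ℤₚ.*-zeroʳ x)) }
  ; -‿homo = λ x → pointwise λ { zero → refl ; (suc n) → refl }
  ; 0-homo = ≈-refl
  ; 1-homo = ≈-refl
  }

constant-≟ : ∀ x y → Maybe (constant x ≈ constant y)
constant-≟ x y with x ℤ.≟ y
... | yes refl = just ≈-refl
... | no _     = nothing

open import Algebra.Solver.Ring ℤ-rawRing seriesACR constant-homo constant-≟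
  using (solve; _:+_; _:*_; :-_; _:=_; con)

t u : Series
t zero          = 0ℤ
t (suc zero)    = 1ℤ
t (suc (suc n)) = 0ℤ
u = 𝟏 ⊕ ⊖ t

t-⊛-suc : ∀ f n → (t ⊛ f) (suc n) ≡ f n
t-⊛-suc f n = trans (cong₂ _+_ (ℤₚ.*-zeroˡ (f (suc n)))
  (trans (⊛-cong-at {f = tail t} {f′ = 𝟏} {g = f} (λ { zero → refl ; (suc m) → refl }) (λ _ → refl) n)
         (⊛-identityˡ-at f n))) (ℤₚ.+-identityˡ (f n))

-- D = t d/dt
D : Series → Series
D f n = + n * f n

-- Since `tail (D f)` is `tail f ⊕ D (tail f)`, the factor `suc n` splits as `1 + n`, and the part
-- with `n` is the induction hypothesis.
D-⊛-at : ∀ f g n → D (f ⊛ g) n ≡ (D f ⊛ g) n + (f ⊛ D g) n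
D-⊛-at f g zero    = lemma (f 0) (g 0)
  where
  lemma : ∀ a b → + 0 * (a * b) ≡ + 0 * a * b + a * (+ 0 * b)
  lemma = solve-∀
D-⊛-at f g (suc n) = begin
  (+ suc n) * (f 0 * g (suc n) + (tail f ⊛ g) n)
    ≡⟨ lemma₁ (+ n) (f 0 * g (suc n)) ((tail f ⊛ g) n) ⟩
  (+ suc n) * (f 0 * g (suc n)) + ((tail f ⊛ g) n + + n * (tail f ⊛ g) n)
    ≡⟨ cong (λ e → (+ suc n) * (f 0 * g (suc n)) + ((tail f ⊛ g) n + e)) (D-⊛-at (tail f) g n) ⟩
  (+ suc n) * (f 0 * g (suc n)) + ((tail f ⊛ g) n + ((D (tail f) ⊛ g) n + (tail f ⊛ D g) n))
    ≡⟨ lemma₂ (+ suc n) (f 0) (g (suc n)) ((tail f ⊛ g) n) ((D (tail f) ⊛ g) n) ((tail f ⊛ D g) n) ⟩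
  (+ 0 * f 0 * g (suc n) + ((tail f ⊛ g) n + (D (tail f) ⊛ g) n)) + (f 0 * ((+ suc n) * g (suc n)) + (tail f ⊛ D g) n)
    ≡⟨ cong (λ e → (+ 0 * f 0 * g (suc n) + e) + (f 0 * ((+ suc n) * g (suc n)) + (tail f ⊛ D g) n))
         (trans (sym (⊛-distribʳ-at g (tail f) (D (tail f)) n))
                (⊛-cong-at {g = g} (λ m → sym (lemma₃ (+ m) (f (suc m)))) (λ _ → refl) n)) ⟩
  (D f ⊛ g) (suc n) + (f ⊛ D g) (suc n) ∎
  where
  open ≡-Reasoning
  lemma₁ : ∀ k x y → (1ℤ + k) * (x + y) ≡ (1ℤ + k) * x + (y + k * y)
  lemma₁ = solve-∀
  lemma₂ : ∀ k a b x y z → k * (a * b) + (x + (y + z)) ≡ (+ 0 * a * b + (x + y)) + (a * (k * b) + z)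
  lemma₂ = solve-∀
  lemma₃ : ∀ k x → (1ℤ + k) * x ≡ x + k * x
  lemma₃ = solve-∀

D-⊛ : ∀ f g → D (f ⊛ g) ≈ D f ⊛ g ⊕ f ⊛ D g
D-⊛ f g = pointwise (D-⊛-at f g)

open import Algebra.Properties.Semiring.Exp Ring.semiring using (_^_; ^-homo-*)
import Relation.Binary.Reasoning.Setoid Ring.setoid as ≈-Reasoning

⊕-congˡ : ∀ h {f g} → f ≈ g → h ⊕ f ≈ h ⊕ g
⊕-congˡ h p = pointwise λ n → cong (λ e → h n + e) (at p n)

⊕-congʳ : ∀ h {f g} → f ≈ g → f ⊕ h ≈ g ⊕ h
⊕-congʳ h p = pointwise λ n → cong (λ e → e + h n) (at p n)

constant-suc : ∀ n → constant (+ suc n) ≈ 𝟏 ⊕ constant (+ n)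
constant-suc n = pointwise λ { zero → refl ; (suc m) → refl }

D-cong : ∀ {f g} → f ≈ g → D f ≈ D g
D-cong p = pointwise λ n → cong (λ e → + n * e) (at p n)

D-⊕ : ∀ f g → D (f ⊕ g) ≈ D f ⊕ D g
D-⊕ f g = pointwise λ n → ℤₚ.*-distribˡ-+ (+ n) (f n) (g n)

D-𝟎 : D 𝟎 ≈ 𝟎
D-𝟎 = pointwise λ { zero → refl ; (suc n) → ℤₚ.*-zeroʳ (+ suc n) }

D-𝟏 : D 𝟏 ≈ 𝟎
D-𝟏 = pointwise λ { zero → refl ; (suc n) → ℤₚ.*-zeroʳ (+ suc n) }

D-t : D t ≈ t
D-t = pointwise λ { zero → refl ; (suc zero) → refl ; (suc (suc n)) → ℤₚ.*-zeroʳ (+ suc (suc n)) }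

D-u : D u ≈ ⊖ t
D-u = pointwise λ { zero → refl ; (suc zero) → refl ; (suc (suc n)) → ℤₚ.*-zeroʳ (+ suc (suc n)) }

-- The extra factor `u` clears the exponent `n - 1` that differentiation would produce.
D-u^ : ∀ n → u ⊛ D (u ^ n) ≈ ⊖ (constant (+ n) ⊛ t ⊛ u ^ n)
D-u^ zero = begin
  u ⊛ D 𝟏                  ≈⟨ Ring.*-congˡ D-𝟏 ⟩
  u ⊛ 𝟎                    ≈⟨ solve 2 (λ u t → u :* con 0ℤ := :- (con 0ℤ :* t :* con 1ℤ)) ≈-refl u t ⟩
  ⊖ (constant 0ℤ ⊛ t ⊛ 𝟏)  ∎
  where open ≈-Reasoning
D-u^ (suc n) = begin
  u ⊛ D (u ⊛ u ^ n)                   ≈⟨ Ring.*-congˡ (D-⊛ u (u ^ n)) ⟩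
  u ⊛ (D u ⊛ u ^ n ⊕ u ⊛ D (u ^ n))   ≈⟨ Ring.*-congˡ (Ring.+-cong (Ring.*-congʳ D-u) (D-u^ n)) ⟩
  u ⊛ (⊖ t ⊛ u ^ n ⊕ ⊖ (constant (+ n) ⊛ t ⊛ u ^ n))
    ≈⟨ solve 4 (λ u t v c → u :* (:- t :* v :+ :- (c :* t :* v)) := :- ((con 1ℤ :+ c) :* t :* (u :* v)))
         ≈-refl u t (u ^ n) (constant (+ n)) ⟩
  ⊖ ((𝟏 ⊕ constant (+ n)) ⊛ t ⊛ u ^ suc n)
    ≈⟨ Ring.-‿cong (Ring.*-congʳ (Ring.*-congʳ (constant-suc n))) ⟨
  ⊖ (constant (+ suc n) ⊛ t ⊛ u ^ suc n) ∎
  where open ≈-Reasoning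

-- Eulerian polynomials and γ-positivity

powers : ℕ → Series
powers p m = (+ suc m) ℤ.^ p

powers-suc : ∀ p → powers (suc p) ≈ powers p ⊕ D (powers p)
powers-suc p = pointwise λ m → lemma (+ m) (powers p m)
  where
  lemma : ∀ m x → (1ℤ + m) * x ≡ x + m * x
  lemma = solve-∀

-- For p ≥ 1, the p-th Eulerian polynomial (with constant coefficient 1).
eulerian : ℕ → Series
eulerian p = u ^ suc p ⊛ powers p

-- The classical recurrence A_(p+1) = (1 + p t) A_p + t (1 - t) A_p'. It comes from `powers-suc` by
-- moving `D` past the prefactor `u ^ suc p`.
eulerian-suc : ∀ p → eulerian (suc p) ≈
  (𝟏 ⊕ constant (+ p) ⊛ t) ⊛ eulerian p ⊕ u ⊛ D (eulerian p)
eulerian-suc p = begin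
  u ⊛ v ⊛ powers (suc p)
    ≈⟨ Ring.*-congˡ (powers-suc p) ⟩
  u ⊛ v ⊛ (P ⊕ D P)
    ≈⟨ solve 5 (λ t c v P P′ →
         (con 1ℤ :+ :- t) :* v :* (P :+ P′) :=
         (con 1ℤ :+ c :* t) :* (v :* P) :+ (:- ((con 1ℤ :+ c) :* t :* v) :* P :+ (con 1ℤ :+ :- t) :* v :* P′))
         ≈-refl t (constant (+ p)) v P (D P) ⟩
  (𝟏 ⊕ constant (+ p) ⊛ t) ⊛ (v ⊛ P) ⊕ (⊖ ((𝟏 ⊕ constant (+ p)) ⊛ t ⊛ v) ⊛ P ⊕ u ⊛ v ⊛ D P)
    ≈⟨ ⊕-congˡ w (⊕-congʳ (u ⊛ v ⊛ D P) (Ring.*-congʳ (Ring.-‿cong (Ring.*-congʳ (Ring.*-congʳ (constant-suc p)))))) ⟨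
  (𝟏 ⊕ constant (+ p) ⊛ t) ⊛ (v ⊛ P) ⊕ (⊖ (constant (+ suc p) ⊛ t ⊛ v) ⊛ P ⊕ u ⊛ v ⊛ D P)
    ≈⟨ ⊕-congˡ w (⊕-congʳ (u ⊛ v ⊛ D P) (Ring.*-congʳ (D-u^ (suc p)))) ⟨
  (𝟏 ⊕ constant (+ p) ⊛ t) ⊛ (v ⊛ P) ⊕ (u ⊛ D v ⊛ P ⊕ u ⊛ v ⊛ D P)
    ≈⟨ ⊕-congˡ w (solve 5 (λ u v v′ P P′ → u :* v′ :* P :+ u :* v :* P′ := u :* (v′ :* P :+ v :* P′))
         ≈-refl u v (D v) P (D P)) ⟩
  (𝟏 ⊕ constant (+ p) ⊛ t) ⊛ (v ⊛ P) ⊕ u ⊛ (D v ⊛ P ⊕ v ⊛ D P)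
    ≈⟨ ⊕-congˡ w (Ring.*-congˡ (D-⊛ v P)) ⟨
  (𝟏 ⊕ constant (+ p) ⊛ t) ⊛ (v ⊛ P) ⊕ u ⊛ D (v ⊛ P) ∎
  where
  open ≈-Reasoning
  v P w : Series
  v = u ^ suc p
  P = powers p
  w = (𝟏 ⊕ constant (+ p) ⊛ t) ⊛ (v ⊛ P)

t-⊛-zero : ∀ f → (t ⊛ f) 0 ≡ 0ℤ
t-⊛-zero f = ℤₚ.*-zeroˡ (f 0)

𝟏⊕t-⊛-zero : ∀ f → ((𝟏 ⊕ t) ⊛ f) 0 ≡ f 0
𝟏⊕t-⊛-zero f = ℤₚ.*-identityˡ (f 0)

𝟏⊕t-⊛-suc : ∀ f n → ((𝟏 ⊕ t) ⊛ f) (suc n) ≡ f (suc n) + f n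
𝟏⊕t-⊛-suc f n = trans (⊛-distribʳ-at f 𝟏 t (suc n)) (cong₂ _+_ (⊛-identityˡ-at f (suc n)) (t-⊛-suc f n))

u-⊛ : ∀ f → u ⊛ f ≈ f ⊕ ⊖ (t ⊛ f)
u-⊛ f = solve 2 (λ t f → (con 1ℤ :+ :- t) :* f := f :+ :- (t :* f)) ≈-refl t f

eulerian-0 : eulerian 0 ≈ 𝟏
eulerian-0 = begin
  u ⊛ 𝟏 ⊛ powers 0              ≈⟨ solve 2 (λ u p → u :* con 1ℤ :* p := u :* p) ≈-refl u (powers 0) ⟩
  u ⊛ powers 0                  ≈⟨ u-⊛ (powers 0) ⟩
  powers 0 ⊕ ⊖ (t ⊛ powers 0)   ≈⟨ pointwise (λ { zero → refl ; (suc n) → cong (λ e → 1ℤ + - e) (t-⊛-suc (powers 0) n) }) ⟩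
  𝟏                             ∎
  where open ≈-Reasoning

eulerian-1 : eulerian 1 ≈ 𝟏
eulerian-1 = begin
  eulerian 1                                              ≈⟨ eulerian-suc 0 ⟩
  (𝟏 ⊕ constant 0ℤ ⊛ t) ⊛ eulerian 0 ⊕ u ⊛ D (eulerian 0)
    ≈⟨ Ring.+-cong (Ring.*-congˡ eulerian-0) (Ring.*-congˡ (≈-trans (D-cong eulerian-0) D-𝟏)) ⟩
  (𝟏 ⊕ constant 0ℤ ⊛ t) ⊛ 𝟏 ⊕ u ⊛ 𝟎
    ≈⟨ solve 2 (λ u t → (con 1ℤ :+ con 0ℤ :* t) :* con 1ℤ :+ u :* con 0ℤ := con 1ℤ) ≈-refl u t ⟩
  𝟏 ∎
  where open ≈-Reasoning

-- Γ o (o + s) is the cone spanned by the γ-basis t^j (1 + t)^(s - 2j).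
data Γ (o : ℕ) : ℕ → Series → Set where
  one  : Γ o o 𝟏
  nil  : ∀ {s} → Γ o s 𝟎
  add  : ∀ {s f g} → Γ o s f → Γ o s g → Γ o s (f ⊕ g)
  [1+t]· : ∀ {s f} → Γ o s f → Γ o (suc s) ((𝟏 ⊕ t) ⊛ f)
  t·   : ∀ {s f} → Γ o s f → Γ o (suc (suc s)) (t ⊛ f)
  resp : ∀ {s f g} → f ≈ g → Γ o s f → Γ o s g

-- Products of γ-basis elements are γ-basis elements. The left factor has offset 0, so the offset of
-- the right one survives.
Γ-⊛ : ∀ {o r s f g} → Γ 0 s f → Γ o r g → Γ o (s ℕ.+ r) (f ⊛ g)
Γ-⊛ {g = g} one           q = resp (≈-sym (⊛-identityˡ g)) q
Γ-⊛ {g = g} nil           q = resp (≈-sym (Ring.zeroˡ g)) nil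
Γ-⊛ {g = g} (add p p′)    q = resp (≈-sym (⊛-distribʳ g _ _)) (add (Γ-⊛ p q) (Γ-⊛ p′ q))
Γ-⊛ {g = g} ([1+t]· p)    q = resp (≈-sym (Ring.*-assoc _ _ g)) ([1+t]· (Γ-⊛ p q))
Γ-⊛ {g = g} (t· p)        q = resp (≈-sym (Ring.*-assoc _ _ g)) (t· (Γ-⊛ p q))
Γ-⊛ {g = g} (resp e p)    q = resp (Ring.*-congʳ e) (Γ-⊛ p q)

eulerianStep : ℕ → Series → Series
eulerianStep p f = (𝟏 ⊕ constant (+ p) ⊛ t) ⊛ f ⊕ u ⊛ D f

eulerianStep-cong : ∀ p {f g} → f ≈ g → eulerianStep p f ≈ eulerianStep p g
eulerianStep-cong p e = Ring.+-cong (Ring.*-congˡ e) (Ring.*-congˡ (D-cong e))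

-- Commuting the step past `1 + t` leaves the remainder `2 t f`, which is nonnegative in the
-- γ-basis.
eulerianStep-[1+t]· : ∀ p f → eulerianStep (suc p) ((𝟏 ⊕ t) ⊛ f) ≈
  (𝟏 ⊕ t) ⊛ eulerianStep p f ⊕ (t ⊛ f ⊕ t ⊛ f)
eulerianStep-[1+t]· p f = begin
  (𝟏 ⊕ constant (+ suc p) ⊛ t) ⊛ ((𝟏 ⊕ t) ⊛ f) ⊕ u ⊛ D ((𝟏 ⊕ t) ⊛ f)
    ≈⟨ Ring.+-cong (Ring.*-congʳ (⊕-congˡ 𝟏 (Ring.*-congʳ (constant-suc p))))
                (Ring.*-congˡ (≈-trans (D-⊛ (𝟏 ⊕ t) f) (⊕-congʳ ((𝟏 ⊕ t) ⊛ D f) (Ring.*-congʳ (≈-trans (D-⊕ 𝟏 t) (Ring.+-cong D-𝟏 D-t)))))) ⟩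
  (𝟏 ⊕ (𝟏 ⊕ constant (+ p)) ⊛ t) ⊛ ((𝟏 ⊕ t) ⊛ f) ⊕ u ⊛ ((𝟎 ⊕ t) ⊛ f ⊕ (𝟏 ⊕ t) ⊛ D f)
    ≈⟨ solve 4 (λ t c f f′ → let [1+t] = con 1ℤ :+ t; u = con 1ℤ :+ :- t in
         (con 1ℤ :+ (con 1ℤ :+ c) :* t) :* ([1+t] :* f) :+ u :* ((con 0ℤ :+ t) :* f :+ [1+t] :* f′) :=
         [1+t] :* ((con 1ℤ :+ c :* t) :* f :+ u :* f′) :+ (t :* f :+ t :* f))
         ≈-refl t (constant (+ p)) f (D f) ⟩
  (𝟏 ⊕ t) ⊛ eulerianStep p f ⊕ (t ⊛ f ⊕ t ⊛ f) ∎
  where open ≈-Reasoning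

eulerianStep-t· : ∀ p f → eulerianStep (suc (suc p)) (t ⊛ f) ≈
  t ⊛ eulerianStep p f ⊕ (𝟏 ⊕ t) ⊛ (t ⊛ f)
eulerianStep-t· p f = begin
  (𝟏 ⊕ constant (+ suc (suc p)) ⊛ t) ⊛ (t ⊛ f) ⊕ u ⊛ D (t ⊛ f)
    ≈⟨ Ring.+-cong (Ring.*-congʳ (⊕-congˡ 𝟏 (Ring.*-congʳ (≈-trans (constant-suc (suc p)) (⊕-congˡ 𝟏 (constant-suc p))))))
                (Ring.*-congˡ (≈-trans (D-⊛ t f) (⊕-congʳ (t ⊛ D f) (Ring.*-congʳ D-t)))) ⟩
  (𝟏 ⊕ (𝟏 ⊕ (𝟏 ⊕ constant (+ p))) ⊛ t) ⊛ (t ⊛ f) ⊕ u ⊛ (t ⊛ f ⊕ t ⊛ D f)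
    ≈⟨ solve 4 (λ t c f f′ → let u = con 1ℤ :+ :- t in
         (con 1ℤ :+ (con 1ℤ :+ (con 1ℤ :+ c)) :* t) :* (t :* f) :+ u :* (t :* f :+ t :* f′) :=
         t :* ((con 1ℤ :+ c :* t) :* f :+ u :* f′) :+ (con 1ℤ :+ t) :* (t :* f))
         ≈-refl t (constant (+ p)) f (D f) ⟩
  t ⊛ eulerianStep p f ⊕ (𝟏 ⊕ t) ⊛ (t ⊛ f) ∎
  where open ≈-Reasoning

-- The step is linear, and the two commutation rules push it through `1 + t` and `t` down to `𝟏`
-- with only nonnegative remainders. Its parameter is `suc s` because `eulerian (suc s)` has index
-- `s`.
Γ-eulerianStep : ∀ {s f} → Γ 0 s f → Γ 0 (suc s) (eulerianStep (suc s) f)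
Γ-eulerianStep one = resp
  (begin
    (𝟏 ⊕ t) ⊛ 𝟏                       ≈⟨ solve 2 (λ t u → (con 1ℤ :+ t) :* con 1ℤ :=
                                            (con 1ℤ :+ con 1ℤ :* t) :* con 1ℤ :+ u :* con 0ℤ) ≈-refl t u ⟩
    (𝟏 ⊕ 𝟏 ⊛ t) ⊛ 𝟏 ⊕ u ⊛ 𝟎           ≈⟨ ⊕-congˡ ((𝟏 ⊕ 𝟏 ⊛ t) ⊛ 𝟏) (Ring.*-congˡ D-𝟏) ⟨
    eulerianStep 1 𝟏                  ∎)
  ([1+t]· one)
  where open ≈-Reasoning
Γ-eulerianStep {s} nil = resp
  (begin
    𝟎                               ≈⟨ solve 2 (λ a u → con 0ℤ := a :* con 0ℤ :+ u :* con 0ℤ) ≈-refl (𝟏 ⊕ constant (+ suc s) ⊛ t) u ⟩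
    (𝟏 ⊕ constant (+ suc s) ⊛ t) ⊛ 𝟎 ⊕ u ⊛ 𝟎  ≈⟨ ⊕-congˡ ((𝟏 ⊕ constant (+ suc s) ⊛ t) ⊛ 𝟎) (Ring.*-congˡ D-𝟎) ⟨
    eulerianStep (suc s) 𝟎          ∎)
  nil
  where open ≈-Reasoning
Γ-eulerianStep {s} (add {f = f} {g} p q) = resp
  (begin
    (a ⊛ f ⊕ u ⊛ D f) ⊕ (a ⊛ g ⊕ u ⊛ D g)
      ≈⟨ solve 6 (λ a u f f′ g g′ → (a :* f :+ u :* f′) :+ (a :* g :+ u :* g′) := a :* (f :+ g) :+ u :* (f′ :+ g′))
           ≈-refl a u f (D f) g (D g) ⟩
    a ⊛ (f ⊕ g) ⊕ u ⊛ (D f ⊕ D g)  ≈⟨ ⊕-congˡ (a ⊛ (f ⊕ g)) (Ring.*-congˡ (D-⊕ f g)) ⟨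
    eulerianStep (suc s) (f ⊕ g) ∎)
  (add (Γ-eulerianStep p) (Γ-eulerianStep q))
  where
  open ≈-Reasoning
  a : Series
  a = 𝟏 ⊕ constant (+ suc s) ⊛ t
Γ-eulerianStep ([1+t]· p) =
  resp (≈-sym (eulerianStep-[1+t]· _ _)) (add ([1+t]· (Γ-eulerianStep p)) (add (t· p) (t· p)))
Γ-eulerianStep (t· p) =
  resp (≈-sym (eulerianStep-t· _ _)) (add (t· (Γ-eulerianStep p)) ([1+t]· (t· p)))
Γ-eulerianStep (resp e p) = resp (eulerianStep-cong _ e) (Γ-eulerianStep p)

eulerian-Γ : ∀ p → Γ 0 p (eulerian (suc p))
eulerian-Γ zero    = resp (≈-sym eulerian-1) one
eulerian-Γ (suc p) = resp (≈-sym (eulerian-suc (suc p))) (Γ-eulerianStep (eulerian-Γ p))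

-- Each generator raises the degree by at most what it adds to `s`. For `s < o` only zero remains,
-- so an offset can encode degree -1.
Γ-vanish : ∀ {o s f} → Γ o s f → ∀ i → s < i ℕ.+ o → f i ≡ 0ℤ
Γ-vanish one zero    o<o = ⊥-elim (ℕₚ.<-irrefl refl o<o)
Γ-vanish one (suc i) _   = refl
Γ-vanish nil i       _   = 𝟎-at i
Γ-vanish (add p q) i lt  = cong₂ _+_ (Γ-vanish p i lt) (Γ-vanish q i lt)
Γ-vanish ([1+t]· {f = f} p) zero    lt = trans (𝟏⊕t-⊛-zero f) (Γ-vanish p 0 (ℕₚ.<-trans (ℕₚ.n<1+n _) lt))
Γ-vanish ([1+t]· {f = f} p) (suc i) (s≤s lt) = trans (𝟏⊕t-⊛-suc f i)
  (cong₂ _+_ (Γ-vanish p (suc i) (ℕₚ.m<n⇒m<1+n lt)) (Γ-vanish p i lt))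
Γ-vanish (t· {f = f} p) zero    lt = t-⊛-zero f
Γ-vanish (t· {f = f} p) (suc i) (s≤s lt) = trans (t-⊛-suc f i) (Γ-vanish p i (ℕₚ.<-trans (ℕₚ.n<1+n _) lt))
Γ-vanish (resp e p) i lt = trans (sym (at e i)) (Γ-vanish p i lt)

Γ-nonneg : ∀ {o s f} → Γ o s f → ∀ i → 0ℤ ℤ.≤ f i
Γ-nonneg one zero    = ℤ.+≤+ z≤n
Γ-nonneg one (suc i) = ℤ.+≤+ z≤n
Γ-nonneg nil i       = ℤₚ.≤-reflexive (sym (𝟎-at i))
Γ-nonneg (add p q) i = ℤₚ.+-mono-≤ (Γ-nonneg p i) (Γ-nonneg q i)
Γ-nonneg ([1+t]· {f = f} p) zero    = subst (0ℤ ℤ.≤_) (sym (𝟏⊕t-⊛-zero f)) (Γ-nonneg p 0)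
Γ-nonneg ([1+t]· {f = f} p) (suc i) = subst (0ℤ ℤ.≤_) (sym (𝟏⊕t-⊛-suc f i)) (ℤₚ.+-mono-≤ (Γ-nonneg p (suc i)) (Γ-nonneg p i))
Γ-nonneg (t· {f = f} p) zero    = ℤₚ.≤-reflexive (sym (t-⊛-zero f))
Γ-nonneg (t· {f = f} p) (suc i) = subst (0ℤ ℤ.≤_) (sym (t-⊛-suc f i)) (Γ-nonneg p i)
Γ-nonneg (resp e p) i = subst (0ℤ ℤ.≤_) (at e i) (Γ-nonneg p i)

private
  shift : ∀ i j o → i ℕ.+ suc j ℕ.+ o ≡ suc (i ℕ.+ j ℕ.+ o)
  shift i j o = cong (ℕ._+ o) (ℕₚ.+-suc i j)

  [1+t]·-last : ∀ {o s f} → Γ o s f → ∀ j → j ℕ.+ o ≡ s → ((𝟏 ⊕ t) ⊛ f) (suc j) ≡ f j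
  [1+t]·-last {f = f} p j refl = trans (𝟏⊕t-⊛-suc f j)
    (trans (cong (λ x → x + f j) (Γ-vanish p (suc j) (ℕₚ.n<1+n _))) (ℤₚ.+-identityˡ (f j)))

  t·-last : ∀ {o s f} → Γ o s f → ∀ j → j ℕ.+ o ≡ suc s → (t ⊛ f) (suc j) ≡ 0ℤ
  t·-last {f = f} p j e = trans (t-⊛-suc f j) (Γ-vanish p j (ℕₚ.≤-reflexive (sym e)))

-- All generators are palindromic: multiplying by `1 + t` moves the centre by 1/2, multiplying by
-- `t` moves it by 1.
Γ-symmetric : ∀ {o s f} → Γ o s f → ∀ i j → i ℕ.+ j ℕ.+ o ≡ s → f i ≡ f j
Γ-symmetric one i j e with ℕₚ.m+n≡0⇒m≡0 i i+j≡0 | ℕₚ.m+n≡0⇒n≡0 i i+j≡0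
  where i+j≡0 = ℕₚ.+-cancelʳ-≡ _ (i ℕ.+ j) 0 e
... | refl | refl = refl
Γ-symmetric nil i j e = trans (𝟎-at i) (sym (𝟎-at j))
Γ-symmetric (add p q) i j e = cong₂ _+_ (Γ-symmetric p i j e) (Γ-symmetric q i j e)
Γ-symmetric ([1+t]· p) zero zero e = refl
Γ-symmetric ([1+t]· {f = f} p) zero (suc j) e =
  trans (𝟏⊕t-⊛-zero f) (trans (Γ-symmetric p 0 j (ℕₚ.suc-injective e)) (sym ([1+t]·-last p j (ℕₚ.suc-injective e))))
Γ-symmetric {o} ([1+t]· {f = f} p) (suc i) zero e =
  trans ([1+t]·-last p i (trans (cong (ℕ._+ o) (sym (ℕₚ.+-identityʳ i))) (ℕₚ.suc-injective e)))
        (trans (Γ-symmetric p i 0 (ℕₚ.suc-injective e)) (sym (𝟏⊕t-⊛-zero f)))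
Γ-symmetric {o} ([1+t]· {f = f} p) (suc i) (suc j) e = begin
  ((𝟏 ⊕ t) ⊛ f) (suc i)  ≡⟨ 𝟏⊕t-⊛-suc f i ⟩
  f (suc i) + f i        ≡⟨ cong₂ _+_ (Γ-symmetric p (suc i) j (trans (sym (shift i j o)) (ℕₚ.suc-injective e)))
                                      (Γ-symmetric p i (suc j) (ℕₚ.suc-injective e)) ⟩
  f j + f (suc j)        ≡⟨ ℤₚ.+-comm (f j) _ ⟩
  f (suc j) + f j        ≡⟨ 𝟏⊕t-⊛-suc f j ⟨
  ((𝟏 ⊕ t) ⊛ f) (suc j)  ∎
  where open ≡-Reasoning
Γ-symmetric (t· p) zero zero e = refl
Γ-symmetric (t· {f = f} p) zero (suc j) e = trans (t-⊛-zero f) (sym (t·-last p j (ℕₚ.suc-injective e)))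
Γ-symmetric {o} (t· {f = f} p) (suc i) zero e =
  trans (t·-last p i (trans (cong (ℕ._+ o) (sym (ℕₚ.+-identityʳ i))) (ℕₚ.suc-injective e))) (sym (t-⊛-zero f))
Γ-symmetric {o} (t· {f = f} p) (suc i) (suc j) e = trans (t-⊛-suc f i)
  (trans (Γ-symmetric p i j (ℕₚ.suc-injective (trans (sym (shift i j o)) (ℕₚ.suc-injective e)))) (sym (t-⊛-suc f j)))
Γ-symmetric (resp eq p) i j e = trans (sym (at eq i)) (trans (Γ-symmetric p i j e) (at eq j))

Γ-increasing : ∀ {o s f} → Γ o s f → ∀ i → suc (i ℕ.+ i ℕ.+ o) ≤ s → f i ℤ.≤ f (suc i)
Γ-increasing one i lt = ⊥-elim (ℕₚ.<-irrefl refl (ℕₚ.≤-trans (s≤s (ℕₚ.m≤n+m _ (i ℕ.+ i))) lt))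
Γ-increasing nil i lt = ℤₚ.≤-reflexive (trans (𝟎-at i) (sym (𝟎-at (suc i))))
Γ-increasing (add p q) i lt = ℤₚ.+-mono-≤ (Γ-increasing p i lt) (Γ-increasing q i lt)
Γ-increasing ([1+t]· {f = f} p) zero lt = begin
  ((𝟏 ⊕ t) ⊛ f) 0  ≡⟨ 𝟏⊕t-⊛-zero f ⟩
  f 0              ≡⟨ ℤₚ.+-identityˡ (f 0) ⟨
  0ℤ + f 0         ≤⟨ ℤₚ.+-monoˡ-≤ (f 0) (Γ-nonneg p 1) ⟩
  f 1 + f 0        ≡⟨ 𝟏⊕t-⊛-suc f 0 ⟨
  ((𝟏 ⊕ t) ⊛ f) 1  ∎
  where open ℤₚ.≤-Reasoning
Γ-increasing {o} ([1+t]· {s} {f} p) (suc i) (s≤s lt) = begin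
  ((𝟏 ⊕ t) ⊛ f) (suc i)        ≡⟨ 𝟏⊕t-⊛-suc f i ⟩
  f (suc i) + f i              ≤⟨ ℤₚ.+-monoʳ-≤ (f (suc i)) middle ⟩
  f (suc i) + f (suc (suc i))  ≡⟨ ℤₚ.+-comm (f (suc i)) _ ⟩
  f (suc (suc i)) + f (suc i)  ≡⟨ 𝟏⊕t-⊛-suc f (suc i) ⟨
  ((𝟏 ⊕ t) ⊛ f) (suc (suc i))  ∎
  where
  open ℤₚ.≤-Reasoning
  -- Below the centre this is two single steps; at the centre `i` and `i + 2` are mirror images.
  middle : f i ℤ.≤ f (suc (suc i))
  middle with ℕₚ.m≤n⇒m<n∨m≡n lt
  ... | inj₁ lt′ = ℤₚ.≤-trans
          (Γ-increasing p i (ℕₚ.≤-trans (s≤s (ℕₚ.+-monoˡ-≤ o (ℕₚ.+-monoʳ-≤ i (ℕₚ.n≤1+n i)))) lt))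
          (Γ-increasing p (suc i) lt′)
  ... | inj₂ e = ℤₚ.≤-reflexive (Γ-symmetric p i (suc (suc i)) (trans (shift i (suc i) o) e))
Γ-increasing (t· {f = f} p) zero lt = subst (0ℤ * f 0 ℤ.≤_) (sym (t-⊛-suc f 0))
  (subst (ℤ._≤ f 0) (sym (ℤₚ.*-zeroˡ (f 0))) (Γ-nonneg p 0))
Γ-increasing {o} (t· {s} {f} p) (suc i) (s≤s lt) = begin
  (t ⊛ f) (suc i)        ≡⟨ t-⊛-suc f i ⟩
  f i                    ≤⟨ Γ-increasing p i (ℕₚ.≤-pred (subst (λ k → suc k ≤ suc s) (shift i i o) lt)) ⟩
  f (suc i)              ≡⟨ t-⊛-suc f (suc i) ⟨
  (t ⊛ f) (suc (suc i))  ∎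
  where open ℤₚ.≤-Reasoning
Γ-increasing (resp e p) i lt = subst (λ x → x ℤ.≤ _) (at e i) (subst (λ x → _ ℤ.≤ x) (at e (suc i)) (Γ-increasing p i lt))

-- Sums over splittings of a vertex set

-- Disjoint unions `U = A ⊔ R`; in the sums below `A` is the layer removed and `R` the rest.
data Split : ∀ {d} → Subset d → Subset d → Subset d → Set where
  []    : Split [] [] []
  out   : ∀ {d} {U A R : Subset d} → Split U A R → Split (false ∷ U) (false ∷ A) (false ∷ R)
  left  : ∀ {d} {U A R : Subset d} → Split U A R → Split (true ∷ U) (true ∷ A) (false ∷ R)
  right : ∀ {d} {U A R : Subset d} → Split U A R → Split (true ∷ U) (false ∷ A) (true ∷ R)

Split-size : ∀ {d} {U A R : Subset d} → Split U A R → (size U) ≡ (size A) ℕ.+ (size R)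
Split-size []        = refl
Split-size (out s)   = Split-size s
Split-size (left s)  = cong suc (Split-size s)
Split-size (right {A = A} {R} s) = trans (cong suc (Split-size s)) (sym (ℕₚ.+-suc (size A) (size R)))

sumSplit : ∀ {X : Set} → (X → X → X) → ∀ {d} → Subset d → (Subset d → Subset d → X) → X
sumSplit _∙_ []          f = f [] []
sumSplit _∙_ (false ∷ U) f = sumSplit _∙_ U (λ A R → f (false ∷ A) (false ∷ R))
sumSplit _∙_ (true ∷ U)  f =
  sumSplit _∙_ U (λ A R → f (true ∷ A) (false ∷ R)) ∙ sumSplit _∙_ U (λ A R → f (false ∷ A) (true ∷ R))

∑ : ∀ {d} → Subset d → (Subset d → Subset d → Series) → Series
∑ = sumSplit _⊕_

∑-at : ∀ {d} (U : Subset d) f n → ∑ U f n ≡ sumSplit _+_ U (λ A R → f A R n)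
∑-at []          f n = refl
∑-at (false ∷ U) f n = ∑-at U _ n
∑-at (true ∷ U)  f n = cong₂ _+_ (∑-at U _ n) (∑-at U _ n)

sumSplit-induction : ∀ {X : Set} {_∙_ : X → X → X} (P : X → Set) → (∀ {x y} → P x → P y → P (x ∙ y)) →
  ∀ {d} (U : Subset d) {f} → (∀ A R → Split U A R → P (f A R)) → P (sumSplit _∙_ U f)
sumSplit-induction P plus []          p = p [] [] []
sumSplit-induction P plus (false ∷ U) p = sumSplit-induction P plus U (λ A R s → p _ _ (out s))
sumSplit-induction P plus (true ∷ U)  p =
  plus (sumSplit-induction P plus U (λ A R s → p _ _ (left s)))
       (sumSplit-induction P plus U (λ A R s → p _ _ (right s)))

sumSplit-≥ : ∀ {d} {U A R : Subset d} {f : Subset d → Subset d → ℤ} →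
  (∀ A R → 0ℤ ℤ.≤ f A R) → Split U A R → f A R ℤ.≤ sumSplit _+_ U f
sumSplit-≥ pos []        = ℤₚ.≤-refl
sumSplit-≥ pos (out s)   = sumSplit-≥ (λ _ _ → pos _ _) s
sumSplit-≥ {U = true ∷ U} {f = f} pos (left {A = A} {R = R} s) = begin
  f (true ∷ A) (false ∷ R)            ≡⟨ ℤₚ.+-identityʳ _ ⟨
  f (true ∷ A) (false ∷ R) + 0ℤ       ≤⟨ ℤₚ.+-mono-≤
    (sumSplit-≥ {f = λ A R → f (true ∷ A) (false ∷ R)} (λ _ _ → pos _ _) s)
    (sumSplit-induction (0ℤ ℤ.≤_) ℤₚ.+-mono-≤ U (λ A R _ → pos (false ∷ A) (true ∷ R))) ⟩
  sumSplit _+_ (true ∷ U) f ∎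
  where open ℤₚ.≤-Reasoning
sumSplit-≥ {U = true ∷ U} {f = f} pos (right {A = A} {R = R} s) = begin
  f (false ∷ A) (true ∷ R)            ≡⟨ ℤₚ.+-identityˡ _ ⟨
  0ℤ + f (false ∷ A) (true ∷ R)       ≤⟨ ℤₚ.+-mono-≤
    (sumSplit-induction (0ℤ ℤ.≤_) ℤₚ.+-mono-≤ U (λ A R _ → pos (true ∷ A) (false ∷ R)))
    (sumSplit-≥ {f = λ A R → f (false ∷ A) (true ∷ R)} (λ _ _ → pos _ _) s) ⟩
  sumSplit _+_ (true ∷ U) f ∎
  where open ℤₚ.≤-Reasoning

∑-cong : ∀ {d} (U : Subset d) {f g} → (∀ A R → Split U A R → f A R ≈ g A R) → ∑ U f ≈ ∑ U g
∑-cong []          p = p [] [] []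
∑-cong (false ∷ U) p = ∑-cong U (λ A R s → p _ _ (out s))
∑-cong (true ∷ U)  p = Ring.+-cong (∑-cong U (λ A R s → p _ _ (left s))) (∑-cong U (λ A R s → p _ _ (right s)))

∑-⊕ : ∀ {d} (U : Subset d) f g → ∑ U (λ A R → f A R ⊕ g A R) ≈ ∑ U f ⊕ ∑ U g
∑-⊕ []          f g = ≈-refl
∑-⊕ (false ∷ U) f g = ∑-⊕ U _ _
∑-⊕ (true ∷ U)  f g = ≈-trans (Ring.+-cong (∑-⊕ U _ _) (∑-⊕ U _ _))
  (solve 4 (λ a b c d → (a :+ b) :+ (c :+ d) := (a :+ c) :+ (b :+ d)) ≈-refl
    (∑ U λ A R → f (true ∷ A) (false ∷ R)) (∑ U λ A R → g (true ∷ A) (false ∷ R))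
    (∑ U λ A R → f (false ∷ A) (true ∷ R)) (∑ U λ A R → g (false ∷ A) (true ∷ R)))

∑-⊛ : ∀ {d} c (U : Subset d) f → ∑ U (λ A R → c ⊛ f A R) ≈ c ⊛ ∑ U f
∑-⊛ c []          f = ≈-refl
∑-⊛ c (false ∷ U) f = ∑-⊛ c U _
∑-⊛ c (true ∷ U)  f = ≈-trans (Ring.+-cong (∑-⊛ c U _) (∑-⊛ c U _)) (≈-sym (Ring.distribˡ c _ _))

∑-𝟎 : ∀ {d} (U : Subset d) → ∑ U (λ A R → 𝟎) ≈ 𝟎
∑-𝟎 []          = ≈-refl
∑-𝟎 (false ∷ U) = ∑-𝟎 U
∑-𝟎 (true ∷ U)  = ≈-trans (Ring.+-cong (∑-𝟎 U) (∑-𝟎 U)) (Ring.+-identityˡ 𝟎)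

-- Both sides run over the ways to send each vertex of `U` to one of three classes `A`, `C`, `R′`,
-- with `D = A ⊔ C`.
∑-interchange : ∀ {d} (U : Subset d) {f g : Subset d → Subset d → Subset d → Subset d → Series} →
  (∀ A R C R′ D → Split U A R → Split R C R′ → Split U D R′ → Split D A C → f A R C R′ ≈ g D R′ A C) →
  ∑ U (λ A R → ∑ R (λ C R′ → f A R C R′)) ≈ ∑ U (λ D R′ → ∑ D (λ A C → g D R′ A C))
∑-interchange []          p = p [] [] [] [] [] [] [] [] []
∑-interchange (false ∷ U) p =
  ∑-interchange U (λ _ _ _ _ _ a b c d → p _ _ _ _ _ (out a) (out b) (out c) (out d))
∑-interchange (true ∷ U) {f} {g} p = begin
  ∑ U (λ A R → ∑ R (λ C R′ → f (true ∷ A) (false ∷ R) (false ∷ C) (false ∷ R′))) ⊕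
  ∑ U (λ A R → ∑ R (λ C R′ → f (false ∷ A) (true ∷ R) (true ∷ C) (false ∷ R′)) ⊕
               ∑ R (λ C R′ → f (false ∷ A) (true ∷ R) (false ∷ C) (true ∷ R′)))
    ≈⟨ Ring.+-cong
         (∑-interchange U (λ _ _ _ _ _ a b c d → p _ _ _ _ _ (left a) (out b) (left c) (left d)))
         (≈-trans (∑-⊕ U _ _) (Ring.+-cong
           (∑-interchange U (λ _ _ _ _ _ a b c d → p _ _ _ _ _ (right a) (left b) (left c) (right d)))
           (∑-interchange U (λ _ _ _ _ _ a b c d → p _ _ _ _ _ (right a) (right b) (right c) (out d))))) ⟩
  inA ⊕ (inC ⊕ inR)  ≈⟨ ≈-sym (Ring.+-assoc inA inC inR) ⟩
  (inA ⊕ inC) ⊕ inR  ≈⟨ ⊕-congʳ inR (∑-⊕ U _ _) ⟨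
  ∑ (true ∷ U) (λ D R′ → ∑ D (λ A C → g D R′ A C)) ∎
  where
  open ≈-Reasoning
  inA inC inR : Series
  inA = ∑ U (λ D R′ → ∑ D (λ A C → g (true ∷ D) (false ∷ R′) (true ∷ A) (false ∷ C)))
  inC = ∑ U (λ D R′ → ∑ D (λ A C → g (true ∷ D) (false ∷ R′) (false ∷ A) (true ∷ C)))
  inR = ∑ U (λ D R′ → ∑ D (λ A C → g (false ∷ D) (true ∷ R′) (false ∷ A) (false ∷ C)))

ifEmpty : ℕ → Series
ifEmpty zero    = 𝟏
ifEmpty (suc _) = 𝟎

∑-ifEmpty : ∀ {d} (U : Subset d) (f : Subset d → Subset d → Series) → ∑ U (λ A R → ifEmpty (size A) ⊛ f A R) ≈ f ⊥ U
∑-ifEmpty []          f = ⊛-identityˡ (f [] [])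
∑-ifEmpty (false ∷ U) f = ∑-ifEmpty U _
∑-ifEmpty (true ∷ U)  f = ≈-trans
  (Ring.+-cong (≈-trans (∑-cong U (λ A R _ → Ring.zeroˡ (f (true ∷ A) (false ∷ R)))) (∑-𝟎 U))
            (∑-ifEmpty U (λ A R → f (false ∷ A) (true ∷ R))))
  (Ring.+-identityˡ _)

-- Coefficientwise the binomial theorem: the sum of (m+1)^|A| over A ⊆ U is (m+2)^|U|. The factor
-- `t` aligns `m` with `m + 1`, which leaves out the constant coefficient 1 of `powers`.
∑-powers : ∀ {d} (U : Subset d) → t ⊛ ∑ U (λ A R → powers (size A)) ≈ powers (size U) ⊕ ⊖ 𝟏
∑-powers U = pointwise λ
  { zero    → trans (t-⊛-zero (∑ U (λ A R → powers (size A)))) (sym (cong (λ e → e + - 1ℤ) (ℤₚ.^-zeroˡ (size U))))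
  ; (suc m) → trans (t-⊛-suc (∑ U (λ A R → powers (size A))) m) (trans (step U m) (sym (ℤₚ.+-identityʳ _))) }
  where
  open ≡-Reasoning
  step : ∀ {d} (U : Subset d) m → ∑ U (λ A R → powers (size A)) m ≡ powers (size U) (suc m)
  step []          m = refl
  step (false ∷ U) m = step U m
  step (true ∷ U)  m = begin
    ∑ U (λ A R → powers (suc (size A))) m + ∑ U (λ A R → powers (size A)) m
      ≡⟨ cong (λ e → e + ∑ U (λ A R → powers (size A)) m) (scaled U) ⟩
    (+ suc m) * ∑ U (λ A R → powers (size A)) m + ∑ U (λ A R → powers (size A)) m
      ≡⟨ cong (λ e → (+ suc m) * e + e) (step U m) ⟩
    (+ suc m) * powers (size U) (suc m) + powers (size U) (suc m)
      ≡⟨ lemma (+ suc m) (powers (size U) (suc m)) ⟩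
    (+ suc (suc m)) * powers (size U) (suc m) ∎
    where
    lemma : ∀ a x → a * x + x ≡ (1ℤ + a) * x
    lemma = solve-∀
    scaled : ∀ {d} (U : Subset d) → ∑ U (λ A R → powers (suc (size A))) m ≡ (+ suc m) * ∑ U (λ A R → powers (size A)) m
    scaled U = trans (∑-at U _ m) (trans (distrib U (λ A R → powers (size A) m)) (cong (λ e → (+ suc m) * e) (sym (∑-at U _ m))))
      where
      distrib : ∀ {d} (U : Subset d) f → sumSplit _+_ U (λ A R → (+ suc m) * f A R) ≡ (+ suc m) * sumSplit _+_ U f
      distrib []          f = refl
      distrib (false ∷ U) f = distrib U _
      distrib (true ∷ U)  f = trans (cong₂ _+_ (distrib U _) (distrib U _)) (sym (ℤₚ.*-distribˡ-+ (+ suc m) (sumSplit _+_ U _) (sumSplit _+_ U _)))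

-- Weighted layers and peeling operators

Family : ℕ → Set
Family d = Subset d → Series

-- What grouping layers into runs requires: by `compose`, two successive layers weigh as much as
-- their union. Low and high layers are the two instances, `freeWeight` and `isolatedWeight`.
record Weight (d : ℕ) : Set where
  field
    weight  : Subset d → Subset d → Series
    unit    : ∀ U → weight ⊥ U ≈ 𝟏
    cone    : ∀ A R → Γ 0 0 (weight A R)
    compose : ∀ {U A R C R′ D} → Split U A R → Split R C R′ → Split U D R′ → Split D A C →
              weight A R ⊛ weight C R′ ≈ weight D R′
open Weight

-- The value 0 at p = 0 makes peel eulerian⁺ run over nonempty layers only.
eulerian⁺ : ℕ → Series
eulerian⁺ zero    = 𝟎
eulerian⁺ (suc p) = eulerian (suc p)

module Peel {d : ℕ} (w : Weight d) where

  peel : (ℕ → Series) → Family d → Family d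
  peel g f U = ∑ U (λ A R → weight w A R ⊛ (g (size A) ⊛ f R))

  sum : Family d → Family d
  sum = peel (λ _ → 𝟏)

  peel-cong : ∀ g {f f′} U → (∀ A R → Split U A R → f R ≈ f′ R) → peel g f U ≈ peel g f′ U
  peel-cong g U p = ∑-cong U (λ A R s → Ring.*-congˡ (Ring.*-congˡ (p A R s)))

  peel-⊕ : ∀ g f f′ U → peel g (λ R → f R ⊕ f′ R) U ≈ peel g f U ⊕ peel g f′ U
  peel-⊕ g f f′ U = ≈-trans
    (∑-cong U (λ A R _ → solve 4 (λ w g f f′ → w :* (g :* (f :+ f′)) := w :* (g :* f) :+ w :* (g :* f′))
       ≈-refl (weight w A R) (g (size A)) (f R) (f′ R)))
    (∑-⊕ U _ _)

  peel-⊛ : ∀ g c f U → peel g (λ R → c ⊛ f R) U ≈ c ⊛ peel g f U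
  peel-⊛ g c f U = ≈-trans
    (∑-cong U (λ A R _ → solve 4 (λ w g c f → w :* (g :* (c :* f)) := c :* (w :* (g :* f)))
       ≈-refl (weight w A R) (g (size A)) c (f R)))
    (∑-⊛ c U _)

  private
    -- Distributing `p` vertices over `m + 1` successive layers, empty ones allowed, can be done in
    -- (m+1)^p ways, so `peel powers` is the sum of the operators `t^m sum^(m+1)`. The factor `u`
    -- normalises `G 0` to 1.
    G G⁺ : ℕ → Series
    G p = u ⊛ powers p
    G⁺ zero    = 𝟎
    G⁺ (suc p) = G (suc p)

  -- Rests on ∑_{A ⊆ D} (m+1)^|A| = (m+2)^|D|; as operators, t·(peel G)·sum = peel G - (1 - t)·sum.
  peel-sum : ∀ f U → t ⊛ peel G (sum f) U ≈ peel G f U ⊕ ⊖ (u ⊛ sum f U)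
  peel-sum f U = begin
    t ⊛ ∑ U (λ A R → weight w A R ⊛ (G (size A) ⊛ sum f R))
      ≈⟨ Ring.*-congˡ (∑-cong U (λ A R _ → ≈-trans (≈-sym (Ring.*-assoc _ _ _)) (≈-sym (∑-⊛ (weight w A R ⊛ G (size A)) R _)))) ⟩
    t ⊛ ∑ U (λ A R → ∑ R (λ C R′ → weight w A R ⊛ G (size A) ⊛ (weight w C R′ ⊛ (𝟏 ⊛ f R′))))
      ≈⟨ Ring.*-congˡ (∑-interchange U {λ A R C R′ → weight w A R ⊛ G (size A) ⊛ (weight w C R′ ⊛ (𝟏 ⊛ f R′))}
           {λ D R′ A C → weight w D R′ ⊛ (u ⊛ f R′) ⊛ powers (size A)} (λ A R C R′ D s₁ s₂ s₃ s₄ → ≈-trans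
           (solve 5 (λ a p c f u → a :* (u :* p) :* (c :* (con 1ℤ :* f)) := (a :* c) :* (u :* f) :* p)
              ≈-refl (weight w A R) (powers (size A)) (weight w C R′) (f R′) u)
           (Ring.*-congʳ {powers (size A)} (Ring.*-congʳ {u ⊛ f R′} (compose w s₁ s₂ s₃ s₄))))) ⟩
    t ⊛ ∑ U (λ D R′ → ∑ D (λ A C → weight w D R′ ⊛ (u ⊛ f R′) ⊛ powers (size A)))
      ≈⟨ ∑-⊛ t U _ ⟨
    ∑ U (λ D R′ → t ⊛ ∑ D (λ A C → weight w D R′ ⊛ (u ⊛ f R′) ⊛ powers (size A)))
      ≈⟨ ∑-cong U (λ D R′ _ → begin
           t ⊛ ∑ D (λ A C → weight w D R′ ⊛ (u ⊛ f R′) ⊛ powers (size A))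
             ≈⟨ Ring.*-congˡ (∑-⊛ (weight w D R′ ⊛ (u ⊛ f R′)) D _) ⟩
           t ⊛ (weight w D R′ ⊛ (u ⊛ f R′) ⊛ ∑ D (λ A C → powers (size A)))
             ≈⟨ solve 3 (λ t a p → t :* (a :* p) := a :* (t :* p)) ≈-refl t (weight w D R′ ⊛ (u ⊛ f R′)) _ ⟩
           weight w D R′ ⊛ (u ⊛ f R′) ⊛ (t ⊛ ∑ D (λ A C → powers (size A)))
             ≈⟨ Ring.*-congˡ (∑-powers D) ⟩
           weight w D R′ ⊛ (u ⊛ f R′) ⊛ (powers (size D) ⊕ ⊖ 𝟏)
             ≈⟨ solve 4 (λ w u f p → w :* (u :* f) :* (p :+ :- con 1ℤ) :=
                  w :* (u :* p :* f) :+ :- u :* (w :* (con 1ℤ :* f))) ≈-refl (weight w D R′) u (f R′) (powers (size D)) ⟩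
           weight w D R′ ⊛ (G (size D) ⊛ f R′) ⊕ ⊖ u ⊛ (weight w D R′ ⊛ (𝟏 ⊛ f R′)) ∎) ⟩
    ∑ U (λ D R′ → weight w D R′ ⊛ (G (size D) ⊛ f R′) ⊕ ⊖ u ⊛ (weight w D R′ ⊛ (𝟏 ⊛ f R′)))
      ≈⟨ ≈-trans (∑-⊕ U _ _) (⊕-congˡ (peel G f U) (∑-⊛ (⊖ u) U _)) ⟩
    peel G f U ⊕ ⊖ u ⊛ sum f U
      ≈⟨ solve 3 (λ p u s → p :+ :- u :* s := p :+ :- (u :* s)) ≈-refl (peel G f U) u (sum f U) ⟩
    peel G f U ⊕ ⊖ (u ⊛ sum f U) ∎
    where open ≈-Reasoning

  -- The empty layer has weight 1 and `G 0` is 1, so it contributes exactly `f U`.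
  peel-G⁺ : ∀ f U → peel G f U ≈ f U ⊕ peel G⁺ f U
  peel-G⁺ f U = begin
    peel G f U
      ≈⟨ ∑-cong U (λ A R _ → split (size A) (weight w A R) (f R)) ⟩
    ∑ U (λ A R → ifEmpty (size A) ⊛ (weight w A R ⊛ f R) ⊕ weight w A R ⊛ (G⁺ (size A) ⊛ f R))
      ≈⟨ ∑-⊕ U _ _ ⟩
    ∑ U (λ A R → ifEmpty (size A) ⊛ (weight w A R ⊛ f R)) ⊕ peel G⁺ f U
      ≈⟨ ⊕-congʳ (peel G⁺ f U) (∑-ifEmpty U (λ A R → weight w A R ⊛ f R)) ⟩
    weight w ⊥ U ⊛ f U ⊕ peel G⁺ f U
      ≈⟨ ⊕-congʳ (peel G⁺ f U) (≈-trans (Ring.*-congʳ (unit w U)) (⊛-identityˡ (f U))) ⟩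
    f U ⊕ peel G⁺ f U ∎
    where
    open ≈-Reasoning
    split : ∀ p a f → a ⊛ (G p ⊛ f) ≈ ifEmpty p ⊛ (a ⊛ f) ⊕ a ⊛ (G⁺ p ⊛ f)
    split zero    a f = ≈-trans
      (Ring.*-congˡ (Ring.*-congʳ (≈-trans (Ring.*-congʳ (≈-sym (Ring.*-identityʳ u))) eulerian-0)))
      (solve 2 (λ a f → a :* (con 1ℤ :* f) := con 1ℤ :* (a :* f) :+ a :* (con 0ℤ :* f)) ≈-refl a f)
    split (suc p) a f = solve 3 (λ a g f → a :* (g :* f) := con 0ℤ :* (a :* f) :+ a :* (g :* f)) ≈-refl a (G (suc p)) f

  -- `eulerian⁺ p` is `u ^ p ⊛ G⁺ p`, and sizes add along a splitting, so the powers of `u` on layer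
  -- and rest merge.
  peel-eulerian : ∀ f U → peel eulerian⁺ (λ R → u ^ size R ⊛ f R) U ≈ u ^ size U ⊛ peel G⁺ f U
  peel-eulerian f U = ≈-trans (∑-cong U (λ A R s → begin
      weight w A R ⊛ (eulerian⁺ (size A) ⊛ (u ^ size R ⊛ f R))
        ≈⟨ Ring.*-congˡ (Ring.*-congʳ (factor (size A))) ⟩
      weight w A R ⊛ (u ^ size A ⊛ G⁺ (size A) ⊛ (u ^ size R ⊛ f R))
        ≈⟨ solve 5 (λ w a g r f → w :* (a :* g :* (r :* f)) := (a :* r) :* (w :* (g :* f)))
             ≈-refl (weight w A R) (u ^ size A) (G⁺ (size A)) (u ^ size R) (f R) ⟩
      (u ^ size A ⊛ u ^ size R) ⊛ (weight w A R ⊛ (G⁺ (size A) ⊛ f R))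
        ≈⟨ Ring.*-congʳ (≈-trans (≈-sym (^-homo-* u (size A) (size R))) (Ring.reflexive (cong (u ^_) (sym (Split-size s))))) ⟩
      u ^ size U ⊛ (weight w A R ⊛ (G⁺ (size A) ⊛ f R)) ∎))
    (∑-⊛ (u ^ size U) U _)
    where
    open ≈-Reasoning
    factor : ∀ p → eulerian⁺ p ≈ u ^ p ⊛ G⁺ p
    factor zero    = solve 0 (con 0ℤ := con 1ℤ :* con 0ℤ) ≈-refl
    factor (suc p) = solve 3 (λ u v p → u :* v :* p := v :* (u :* p)) ≈-refl u (u ^ suc p) (powers (suc p))

  -- As operators, `peel G (1 - t sum) = (1 - t) sum` by `peel-sum`; subtracting `1 - t sum` gives
  -- `peel G⁺ (1 - t sum) = sum - 1`. This condenses a whole run of layers into one Eulerian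
  -- polynomial.
  peel-eulerian-sum : ∀ f U →
    peel eulerian⁺ (λ R → u ^ size R ⊛ (f R ⊕ ⊖ t ⊛ sum f R)) U ≈ u ^ size U ⊛ (sum f U ⊕ ⊖ f U)
  peel-eulerian-sum f U = ≈-trans (peel-eulerian h U) (Ring.*-congˡ (begin
    peel G⁺ h U
      ≈⟨ solve 2 (λ h p → p := :- h :+ (h :+ p)) ≈-refl (h U) (peel G⁺ h U) ⟩
    ⊖ h U ⊕ (h U ⊕ peel G⁺ h U)
      ≈⟨ ⊕-congˡ (⊖ h U) (peel-G⁺ h U) ⟨
    ⊖ h U ⊕ peel G h U
      ≈⟨ ⊕-congˡ (⊖ h U) (≈-trans (peel-⊕ G f (λ R → ⊖ t ⊛ sum f R) U) (⊕-congˡ (peel G f U) (peel-⊛ G (⊖ t) (sum f) U))) ⟩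
    ⊖ h U ⊕ (peel G f U ⊕ ⊖ t ⊛ peel G (sum f) U)
      ≈⟨ solve 4 (λ h g t s → :- h :+ (g :+ :- t :* s) := :- h :+ (g :+ :- (t :* s))) ≈-refl (h U) (peel G f U) t _ ⟩
    ⊖ h U ⊕ (peel G f U ⊕ ⊖ (t ⊛ peel G (sum f) U))
      ≈⟨ ⊕-congˡ (⊖ h U) (⊕-congˡ (peel G f U) (Ring.-‿cong (peel-sum f U))) ⟩
    ⊖ h U ⊕ (peel G f U ⊕ ⊖ (peel G f U ⊕ ⊖ (u ⊛ sum f U)))
      ≈⟨ solve 4 (λ f t s g → :- (f :+ :- t :* s) :+ (g :+ :- (g :+ :- ((con 1ℤ :+ :- t) :* s))) := s :+ :- f)
           ≈-refl (f U) t (sum f U) (peel G f U) ⟩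
    sum f U ⊕ ⊖ f U ∎))
    where
    open ≈-Reasoning
    h : Family d
    h R = f R ⊕ ⊖ t ⊛ sum f R

  peel-eulerian-vanishes : ∀ (f : Family d) U → (∀ R → size R ℕ.< size U → f R ≈ 𝟎) → peel eulerian⁺ f U ≈ 𝟎
  peel-eulerian-vanishes f U p = ≈-trans (∑-cong U (λ A R s → term (size A) (weight w A R) R (Split-size s))) (∑-𝟎 U)
    where
    term : ∀ k a R → size U ≡ k ℕ.+ size R → a ⊛ (eulerian⁺ k ⊛ f R) ≈ 𝟎
    term zero    a R e = solve 2 (λ a f → a :* (con 0ℤ :* f) := con 0ℤ) ≈-refl a (f R)
    term (suc k) a R e = ≈-trans
      (Ring.*-congˡ (Ring.*-congˡ (p R (subst (size R ℕ.<_) (sym e) (s≤s (ℕₚ.m≤n+m (size R) k))))))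
      (solve 2 (λ a g → a :* (g :* con 0ℤ) := con 0ℤ) ≈-refl a (eulerian (suc k)))

  -- A run on `p ≥ 1` vertices adds `p - 1` to the index. The predecessor is expressed through
  -- `suc n` to avoid truncated subtraction; an empty `A` gives zero, which lies in every cone.
  peel-term-Γ : ∀ {o r} (f : Family d) c A R → (∀ R → Γ o (size R ℕ.+ c) (f R)) →
    (∀ n → size A ℕ.+ size R ≡ suc n → n ℕ.+ c ≡ r) → Γ o r (weight w A R ⊛ (eulerian⁺ (size A) ⊛ f R))
  peel-term-Γ {o} {r} f c A R p index = Γ-⊛ (cone w A R) (factor (size A) index)
    where
    factor : ∀ k → (∀ n → k ℕ.+ size R ≡ suc n → n ℕ.+ c ≡ r) → Γ o r (eulerian⁺ k ⊛ f R)
    factor zero    _     = resp (≈-sym (Ring.zeroˡ (f R))) nil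
    factor (suc k) index = subst (λ s → Γ o s (eulerian (suc k) ⊛ f R))
      (trans (sym (ℕₚ.+-assoc k (size R) c)) (index _ refl)) (Γ-⊛ (eulerian-Γ k) (p R))

  peel-Γ : ∀ {o r} (f : Family d) c U → (∀ R → Γ o (size R ℕ.+ c) (f R)) →
    (∀ n → size U ≡ suc n → n ℕ.+ c ≡ r) → Γ o r (peel eulerian⁺ f U)
  peel-Γ f c U p index = sumSplit-induction (Γ _ _) add U
    (λ A R s → peel-term-Γ f c A R p (λ n e → index n (trans (Split-size s) e)))

  -- All summands lie in γ-cones and so have nonnegative coefficients; any one of them bounds the
  -- sum from below.
  peel-≥ : ∀ {o} (f : Family d) c n {U A R} → (∀ R → Γ o (size R ℕ.+ c) (f R)) → Split U A R →
    (weight w A R ⊛ (eulerian⁺ (size A) ⊛ f R)) n ℤ.≤ peel eulerian⁺ f U n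
  peel-≥ f c n {U} p s = subst (λ e → _ ℤ.≤ e) (sym (∑-at U _ n)) (sumSplit-≥
    (λ A R → Γ-nonneg (peel-term-Γ f c A R p (λ m e → cong (λ k → ℕ.pred k ℕ.+ c) (sym e))) n) s)

-- Lattice points, peeled layer by layer

sumTo-head : ∀ f k → sumTo f (suc k) ≡ f 0 + sumTo (f ∘ suc) k
sumTo-head f zero    = refl
sumTo-head f (suc k) = trans (cong (λ e → e + f (suc (suc k))) (sumTo-head f k)) (ℤₚ.+-assoc (f 0) _ _)

sumTo-cong : ∀ {f g} k → (∀ i → i ≤ k → f i ≡ g i) → sumTo f k ≡ sumTo g k
sumTo-cong zero    p = p 0 z≤n
sumTo-cong (suc k) p = cong₂ _+_ (sumTo-cong k (λ i i≤k → p i (ℕₚ.m≤n⇒m≤1+n i≤k))) (p (suc k) ℕₚ.≤-refl)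

sumTo-* : ∀ c f k → sumTo (λ i → c * f i) k ≡ c * sumTo f k
sumTo-* c f zero    = refl
sumTo-* c f (suc k) = trans (cong (λ e → e + c * f (suc k)) (sumTo-* c f k)) (sym (ℤₚ.*-distribˡ-+ c (sumTo f k) _))

sumSplit-cong : ∀ {d} (U : Subset d) {f g : Subset d → Subset d → ℤ} →
  (∀ A R → Split U A R → f A R ≡ g A R) → sumSplit _+_ U f ≡ sumSplit _+_ U g
sumSplit-cong []          p = p [] [] []
sumSplit-cong (false ∷ U) p = sumSplit-cong U (λ A R s → p _ _ (out s))
sumSplit-cong (true ∷ U)  p =
  cong₂ _+_ (sumSplit-cong U (λ A R s → p _ _ (left s))) (sumSplit-cong U (λ A R s → p _ _ (right s)))

sumSplit-+ : ∀ {d} (U : Subset d) (f g : Subset d → Subset d → ℤ) →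
  sumSplit _+_ U (λ A R → f A R + g A R) ≡ sumSplit _+_ U f + sumSplit _+_ U g
sumSplit-+ []          f g = refl
sumSplit-+ (false ∷ U) f g = sumSplit-+ U _ _
sumSplit-+ (true ∷ U)  f g = trans (cong₂ _+_ (sumSplit-+ U _ _) (sumSplit-+ U _ _)) (lemma
    (sumSplit _+_ U λ A R → f (true ∷ A) (false ∷ R)) (sumSplit _+_ U λ A R → g (true ∷ A) (false ∷ R)) _ _)
  where
  lemma : ∀ a b c d → (a + b) + (c + d) ≡ (a + c) + (b + d)
  lemma = solve-∀

sumSplit-sumTo : ∀ {d} (U : Subset d) (f : Subset d → Subset d → ℕ → ℤ) k →
  sumSplit _+_ U (λ A R → sumTo (f A R) k) ≡ sumTo (λ i → sumSplit _+_ U (λ A R → f A R i)) k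
sumSplit-sumTo U f zero    = refl
sumSplit-sumTo U f (suc k) =
  trans (sumSplit-+ U _ _) (cong (λ e → e + sumSplit _+_ U (λ A R → f A R (suc k))) (sumSplit-sumTo U f k))

sumSplit-0 : ∀ {d} (U : Subset d) → sumSplit _+_ U (λ A R → 0ℤ) ≡ 0ℤ
sumSplit-0 []          = refl
sumSplit-0 (false ∷ U) = sumSplit-0 U
sumSplit-0 (true ∷ U)  = cong₂ _+_ (sumSplit-0 U) (sumSplit-0 U)

indicator : ∀ {P : Set} → Dec P → ℤ
indicator p = if does p then 1ℤ else 0ℤ

indicator-⇔ : ∀ {P Q : Set} → P ⇔ Q → (p : Dec P) (q : Dec Q) → indicator p ≡ indicator q
indicator-⇔ e p q = cong (if_then 1ℤ else 0ℤ) (does-⇔ e p q)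

indicator-× : ∀ {P Q : Set} (p : Dec P) (q : Dec Q) → indicator (p ×-dec q) ≡ indicator p * indicator q
indicator-× (yes _) (yes _) = refl
indicator-× (yes _) (no _)  = refl
indicator-× (no _)  (yes _) = refl
indicator-× (no _)  (no _)  = refl

-- Coordinates outside U are fixed to 0, those in U range over {0,…,m}.
sumBox : ∀ {d} → Subset d → ℕ → (Vec ℕ d → ℤ) → ℤ
sumBox []          m f = f []
sumBox (false ∷ U) m f = sumBox U m (λ x → f (0 ∷ x))
sumBox (true ∷ U)  m f = sumTo (λ a → sumBox U m (λ x → f (a ∷ x))) m

sumBox-cong : ∀ {d} (U : Subset d) m {f g : Vec ℕ d → ℤ} →
  (∀ x → (∀ i → lookup x i ≤ m) → f x ≡ g x) → sumBox U m f ≡ sumBox U m g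
sumBox-cong []          m p = p [] (λ ())
sumBox-cong (false ∷ U) m p = sumBox-cong U m (λ x b → p _ (λ { zero → z≤n ; (suc i) → b i }))
sumBox-cong (true ∷ U)  m p =
  sumTo-cong m (λ a a≤m → sumBox-cong U m (λ x b → p _ (λ { zero → a≤m ; (suc i) → b i })))

sumBox-* : ∀ {d} (U : Subset d) m c f → sumBox U m (λ x → c * f x) ≡ c * sumBox U m f
sumBox-* []          m c f = refl
sumBox-* (false ∷ U) m c f = sumBox-* U m c _
sumBox-* (true ∷ U)  m c f = trans (sumTo-cong m (λ a _ → sumBox-* U m c _)) (sumTo-* c _ m)

sumBox-0 : ∀ {d} (U : Subset d) c → sumBox U 0 (λ _ → c) ≡ c
sumBox-0 []          c = refl
sumBox-0 (false ∷ U) c = sumBox-0 U c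
sumBox-0 (true ∷ U)  c = sumBox-0 U c

place : ∀ {d} → Subset d → Subset d → ℕ → Vec ℕ d → Vec ℕ d
place []          []          M []      = []
place (true ∷ B)  (_ ∷ R)     M (a ∷ x) = M ∷ place B R M x
place (false ∷ B) (true ∷ R)  M (a ∷ x) = suc a ∷ place B R M x
place (false ∷ B) (false ∷ R) M (a ∷ x) = 0 ∷ place B R M x

-- A coordinate in `U` is 0, or `m + 2`, or one more than a value up to `m`; these cases define `A`,
-- `B` and `R`.
sumBox-peel : ∀ {d} (U : Subset d) m f → sumBox U (2 ℕ.+ m) f ≡
  sumSplit _+_ U (λ A S → sumSplit _+_ S (λ B R → sumBox R m (λ x → f (place B R (2 ℕ.+ m) x))))
sumBox-peel []          m f = refl
sumBox-peel (false ∷ U) m f = sumBox-peel U m _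
sumBox-peel {suc d} (true ∷ U)  m f = begin
  sumTo g (suc m) + g (2 ℕ.+ m)
    ≡⟨ cong (λ e → e + g (2 ℕ.+ m)) (sumTo-head g m) ⟩
  g 0 + sumTo (g ∘ suc) m + g (2 ℕ.+ m)
    ≡⟨ lemma (g 0) (sumTo (g ∘ suc) m) (g (2 ℕ.+ m)) ⟩
  g 0 + (g (2 ℕ.+ m) + sumTo (g ∘ suc) m)
    ≡⟨ cong₂ _+_ (sumBox-peel U m _) (cong₂ _+_ (sumBox-peel U m _)
         (sumTo-cong m (λ a _ → sumBox-peel U m (λ x → f (suc a ∷ x))))) ⟩
  sumSplit _+_ U (λ A S → sumSplit _+_ S (λ B R → inner B R 0)) +
  (sumSplit _+_ U (λ A S → sumSplit _+_ S (λ B R → inner B R (2 ℕ.+ m))) +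
   sumTo (λ a → sumSplit _+_ U (λ A S → sumSplit _+_ S (λ B R → inner B R (suc a)))) m)
    ≡⟨ cong (λ e → low + (high + e)) (sym (trans
         (sumSplit-cong U (λ A S _ → sumSplit-sumTo S (λ B R a → inner B R (suc a)) m))
         (sumSplit-sumTo U (λ A S a → sumSplit _+_ S (λ B R → inner B R (suc a))) m))) ⟩
  low + (high + sumSplit _+_ U (λ A S → sumSplit _+_ S (λ B R → sumTo (λ a → inner B R (suc a)) m)))
    ≡⟨ cong (λ e → low + e) (sym (sumSplit-+ U _ _)) ⟩
  sumSplit _+_ (true ∷ U) (λ A S → sumSplit _+_ S (λ B R → sumBox R m (λ x → f (place B R (2 ℕ.+ m) x)))) ∎
  where
  open ≡-Reasoning
  g : ℕ → ℤ
  g a = sumBox U (2 ℕ.+ m) (λ x → f (a ∷ x))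
  inner : Subset d → Subset d → ℕ → ℤ
  inner B R a = sumBox R m (λ x → f (a ∷ place B R (2 ℕ.+ m) x))
  low high : ℤ
  low  = sumSplit _+_ U (λ A S → sumSplit _+_ S (λ B R → inner B R 0))
  high = sumSplit _+_ U (λ A S → sumSplit _+_ S (λ B R → inner B R (2 ℕ.+ m)))
  lemma : ∀ a b c → a + b + c ≡ a + (c + b)
  lemma = solve-∀

length-filter-++ : ∀ {A : Set} {P : A → Set} (P? : Decidable P) xs ys →
  + length (filter P? (xs ++ ys)) ≡ + length (filter P? xs) + + length (filter P? ys)
length-filter-++ P? xs ys = trans (cong (+_ ∘ length) (Listₚ.filter-++ P? xs ys))
  (cong +_ (Listₚ.length-++ (filter P? xs)))

length-filter-map : ∀ {A B : Set} {P : B → Set} (P? : Decidable P) (f : A → B) xs →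
  length (filter P? (map f xs)) ≡ length (filter (P? ∘ f) xs)
length-filter-map P? f []       = refl
length-filter-map P? f (x ∷ xs) with does (P? (f x))
... | true  = cong suc (length-filter-map P? f xs)
... | false = length-filter-map P? f xs

length-filter-box : ∀ d m {P : Vec ℕ d → Set} (P? : Decidable P) →
  + length (filter P? (box m d)) ≡ sumBox ⊤ m (λ x → indicator (P? x))
length-filter-box zero    m P? with does (P? [])
... | true  = refl
... | false = refl
length-filter-box (suc d) m P? =
  trans (over (λ a → a) m) (sumTo-cong m (λ a _ → length-filter-box d m (P? ∘ (a ∷_))))
  where
  open ≡-Reasoning
  -- Generalised from `upTo` to an arbitrary `h`, because passing to the tail of the list shifts the
  -- function.
  over : ∀ h k → + length (filter P? (concatMap (λ a → map (a ∷_) (box m d)) (applyUpTo h (suc k)))) ≡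
    sumTo (λ j → + length (filter (P? ∘ (h j ∷_)) (box m d))) k
  over h k = trans (length-filter-++ P? (map (h 0 ∷_) (box m d)) _)
    (trans (cong (λ e → + e + + length (filter P? (concatMap (λ a → map (a ∷_) (box m d)) (applyUpTo (h ∘ suc) k))))
              (length-filter-map P? (h 0 ∷_) (box m d)))
           (rest k))
    where
    rest : ∀ k → + length (filter (P? ∘ (h 0 ∷_)) (box m d)) +
      + length (filter P? (concatMap (λ a → map (a ∷_) (box m d)) (applyUpTo (h ∘ suc) k))) ≡
      sumTo (λ j → + length (filter (P? ∘ (h j ∷_)) (box m d))) k
    rest zero    = ℤₚ.+-identityʳ _
    rest (suc k) = trans (cong (λ e → + length (filter (P? ∘ (h 0 ∷_)) (box m d)) + e) (over (h ∘ suc) k))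
                         (sym (sumTo-head _ k))

T-all-tabulate : ∀ {A : Set} {n} (p : A → Bool) (h : Fin n → A) →
  T (all p (tabulate h)) ⇔ (∀ i → T (p (h i)))
T-all-tabulate {n = zero}  p h = mk⇔ (λ _ ()) (λ _ → _)
T-all-tabulate {n = suc n} p h = mk⇔
  (λ a → λ { zero    → proj₁ (Equivalence.to Boolₚ.T-∧ a)
           ; (suc i) → Equivalence.to (T-all-tabulate p (h ∘ suc)) (proj₂ (Equivalence.to Boolₚ.T-∧ a)) i })
  (λ a → Equivalence.from Boolₚ.T-∧ (a zero , Equivalence.from (T-all-tabulate p (h ∘ suc)) (a ∘ suc)))

-- Edge constraints on lattice points

module Polytope {d : ℕ} (G : SimpleGraph d) where

  Admissible : Subset d → ℕ → Vec ℕ d → Set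
  Admissible U m x = ∀ i j → adj G i j ≡ true → lookup U i ≡ true → lookup U j ≡ true →
    lookup x i ℕ.+ lookup x j ≤ m

  admissible? : ∀ U m x → Dec (Admissible U m x)
  admissible? U m x = Finₚ.all? λ i → Finₚ.all? λ j →
    adj G i j Boolₚ.≟ true →-dec lookup U i Boolₚ.≟ true →-dec lookup U j Boolₚ.≟ true →-dec
    (lookup x i ℕ.+ lookup x j) ℕ.≤? m

  -- No vertex of B has a neighbour in B ∪ R.
  Isolated : Subset d → Subset d → Set
  Isolated B R = ∀ i j → adj G i j ≡ true → lookup B i ≡ true → lookup B j ≡ false × lookup R j ≡ false

  isolated? : ∀ B R → Dec (Isolated B R)
  isolated? B R = Finₚ.all? λ i → Finₚ.all? λ j →
    adj G i j Boolₚ.≟ true →-dec lookup B i Boolₚ.≟ true →-dec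
    (lookup B j Boolₚ.≟ false ×-dec lookup R j Boolₚ.≟ false)

  inNP⇔Admissible : ∀ n x → T (inNP G n x) ⇔ Admissible ⊤ (2 ℕ.* n) x
  inNP⇔Admissible n x = mk⇔
    (λ p i j ij _ _ → ℕₚ.≤ᵇ⇒≤ _ _ (to (adj G i j) ij (Equivalence.to (T-all-tabulate _ (λ k → k))
       (Equivalence.to (T-all-tabulate _ (λ k → k)) p i) j)))
    (λ p → Equivalence.from (T-all-tabulate _ (λ k → k)) λ i → Equivalence.from (T-all-tabulate _ (λ k → k)) λ j →
       from (adj G i j) λ ij → ℕₚ.≤⇒≤ᵇ (p i j ij (Vecₚ.lookup-replicate i true) (Vecₚ.lookup-replicate j true)))
    where
    to : ∀ b {c} → b ≡ true → T (not b ∨ c) → T c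
    to true  _ p = p
    from : ∀ b {c} → (b ≡ true → T c) → T (not b ∨ c)
    from true  p = p refl
    from false p = _

  -- Subsets `U` other than `⊤` enter because peeling leaves the same counting problem on fewer
  -- vertices. Being a `Series`, the counting function doubles as its generating series.
  lattice : Family d
  lattice U n = sumBox U (2 ℕ.* n) (λ x → indicator (admissible? U (2 ℕ.* n) x))

  ehrhart≡lattice : ∀ n → + ehrhart G n ≡ lattice ⊤ n
  ehrhart≡lattice n = trans (length-filter-box d (2 ℕ.* n) (λ x → T? (inNP G n x)))
    (sumBox-cong ⊤ (2 ℕ.* n) (λ x _ → indicator-⇔ (inNP⇔Admissible n x) (T? (inNP G n x)) (admissible? ⊤ (2 ℕ.* n) x)))

  lattice-0 : ∀ U → lattice U 0 ≡ 1ℤ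
  lattice-0 U = trans
    (sumBox-cong U 0 (λ x b → cong (if_then 1ℤ else 0ℤ)
      (dec-true (admissible? U 0 x) (λ i j _ _ _ → ℕₚ.+-mono-≤ (b i) (b j)))))
    (sumBox-0 U 1ℤ)

-- The local form of `Split`: matching on the cell of a vertex fixes its three memberships at once,
-- which drives the case analyses along edges below.
data Cell : Bool → Bool → Bool → Set where
  out   : Cell false false false
  left  : Cell true true false
  right : Cell true false true

Split-lookup : ∀ {d} {U A R : Subset d} → Split U A R → ∀ i → Cell (lookup U i) (lookup A i) (lookup R i)
Split-lookup (out s)   zero    = out
Split-lookup (left s)  zero    = left
Split-lookup (right s) zero    = right
Split-lookup (out s)   (suc i) = Split-lookup s i
Split-lookup (left s)  (suc i) = Split-lookup s i
Split-lookup (right s) (suc i) = Split-lookup s i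

placeAt : Bool → Bool → ℕ → ℕ → ℕ
placeAt true  _     M a = M
placeAt false true  M a = suc a
placeAt false false M a = 0

lookup-place : ∀ {d} (B R : Subset d) M x i →
  lookup (place B R M x) i ≡ placeAt (lookup B i) (lookup R i) M (lookup x i)
lookup-place (true ∷ B)  (_ ∷ R)     M (a ∷ x) zero    = refl
lookup-place (false ∷ B) (true ∷ R)  M (a ∷ x) zero    = refl
lookup-place (false ∷ B) (false ∷ R) M (a ∷ x) zero    = refl
lookup-place (true ∷ B)  (_ ∷ R)     M (a ∷ x) (suc i) = lookup-place B R M x i
lookup-place (false ∷ B) (true ∷ R)  M (a ∷ x) (suc i) = lookup-place B R M x i
lookup-place (false ∷ B) (false ∷ R) M (a ∷ x) (suc i) = lookup-place B R M x i

ε : ∀ {d} → Family d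
ε U = ifEmpty (size U)

sumSplit-ε : ∀ {d} (U : Subset d) → sumSplit _+_ U (λ A R → ε R 0) ≡ 1ℤ
sumSplit-ε []          = refl
sumSplit-ε (false ∷ U) = sumSplit-ε U
sumSplit-ε (true ∷ U)  = cong₂ _+_ (sumSplit-ε U) (sumSplit-0 U)

ε-suc : ∀ {d} (U : Subset d) n → ε U (suc n) ≡ 0ℤ
ε-suc U n with size U
... | zero  = refl
... | suc _ = refl

indicator-Γ : ∀ {P : Set} (p : Dec P) → Γ 0 0 (constant (indicator p))
indicator-Γ (yes _) = one
indicator-Γ (no _)  = nil

freeWeight : ∀ d → Weight d
freeWeight d .weight _ _ = 𝟏
freeWeight d .unit _ = ≈-refl
freeWeight d .cone _ _ = one
freeWeight d .compose _ _ _ _ = ⊛-identityˡ 𝟏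

module Peeling {d : ℕ} (G : SimpleGraph d) where
  open Polytope G public

  module _ {U A S B R : Subset d} (s₁ : Split U A S) (s₂ : Split S B R) (m : ℕ) (x : Vec ℕ d) where

    private
      M : ℕ
      M = 2 ℕ.+ m

      value : Bool → Bool → ℕ → ℕ
      value b r a = placeAt b r M a

    -- Edge by edge: `M` plus a positive value exceeds `M`, which forces isolation of `B`;
    -- `suc a + suc b ≤ 2 + m` means `a + b ≤ m`; and where one end is in `A`, hence 0, the other
    -- end is at most `M`.
    Admissible-place : (∀ i → lookup x i ≤ m) →
      Admissible U M (place B R M x) ⇔ (Isolated B R × Admissible R m x)
    Admissible-place bound = mk⇔ to from
      where
      to : Admissible U M (place B R M x) → Isolated B R × Admissible R m x
      to ok = iso , adm
        where
        at-edge : ∀ i j → adj G i j ≡ true → lookup U i ≡ true → lookup U j ≡ true →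
          value (lookup B i) (lookup R i) (lookup x i) ℕ.+ value (lookup B j) (lookup R j) (lookup x j) ≤ M
        at-edge i j e p q =
          subst (_≤ M) (cong₂ ℕ._+_ (lookup-place B R M x i) (lookup-place B R M x j)) (ok i j e p q)
        iso : Isolated B R
        iso i j e bi with lookup U i | lookup A i | lookup S i | Split-lookup s₁ i
                        | lookup B i | lookup R i | Split-lookup s₂ i | at-edge i j e
        ... | _ | _ | _ | right | _ | _ | left | k
          with lookup U j | lookup A j | lookup S j | Split-lookup s₁ j
             | lookup B j | lookup R j | Split-lookup s₂ j
        ... | _ | _ | _ | out   | _ | _ | out   = refl , refl
        ... | _ | _ | _ | left  | _ | _ | out   = refl , refl
        ... | _ | _ | _ | right | _ | _ | left  = ⊥-elim (ℕₚ.m+1+n≰m M (k refl refl))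
        ... | _ | _ | _ | right | _ | _ | right = ⊥-elim (ℕₚ.m+1+n≰m M (k refl refl))
        adm : Admissible R m x
        adm i j e ri rj with lookup U i | lookup A i | lookup S i | Split-lookup s₁ i
                           | lookup B i | lookup R i | Split-lookup s₂ i | at-edge i j e
        ... | _ | _ | _ | right | _ | _ | right | k
          with lookup U j | lookup A j | lookup S j | Split-lookup s₁ j
             | lookup B j | lookup R j | Split-lookup s₂ j
        ... | _ | _ | _ | right | _ | _ | right = ℕₚ.≤-pred (subst (_≤ suc m) (ℕₚ.+-suc _ _) (ℕₚ.≤-pred (k refl refl)))

      from : Isolated B R × Admissible R m x → Admissible U M (place B R M x)
      from (iso , adm) i j e p q = subst (_≤ M)
        (sym (cong₂ ℕ._+_ (lookup-place B R M x i) (lookup-place B R M x j))) bounded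
        where
        bounded : value (lookup B i) (lookup R i) (lookup x i) ℕ.+ value (lookup B j) (lookup R j) (lookup x j) ≤ M
        bounded with lookup U i | lookup A i | lookup S i | Split-lookup s₁ i
                   | lookup B i | lookup R i | Split-lookup s₂ i
                   | iso i j e | iso j i (trans (symm G j i) e) | adm i j e | bound i
        bounded | _ | _ | _ | left | _ | _ | out | _ | _ | _ | _
          with lookup U j | lookup A j | lookup S j | Split-lookup s₁ j
             | lookup B j | lookup R j | Split-lookup s₂ j | bound j
        ... | _ | _ | _ | left  | _ | _ | out   | _ = z≤n
        ... | _ | _ | _ | right | _ | _ | left  | _ = ℕₚ.≤-refl
        ... | _ | _ | _ | right | _ | _ | right | b = s≤s (ℕₚ.m≤n⇒m≤1+n b)
        bounded | _ | _ | _ | right | _ | _ | left | isoᵢ | _ | _ | _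
          with lookup B j | lookup R j | isoᵢ refl
        ... | _ | _ | refl , refl = ℕₚ.≤-reflexive (ℕₚ.+-identityʳ M)
        bounded | _ | _ | _ | right | _ | _ | right | _ | isoⱼ | admᵢⱼ | b
          with lookup U j | lookup A j | lookup S j | Split-lookup s₁ j
             | lookup B j | lookup R j | Split-lookup s₂ j
        ... | _ | _ | _ | left  | _ | _ | out   = subst (_≤ M) (sym (ℕₚ.+-identityʳ _)) (s≤s (ℕₚ.m≤n⇒m≤1+n b))
        -- An edge from `R` to `B`, read from its end in `B`, contradicts isolation.
        ... | _ | _ | _ | right | _ | _ | left with () ← proj₂ (isoⱼ refl)
        ... | _ | _ | _ | right | _ | _ | right = s≤s (subst (_≤ suc m) (sym (ℕₚ.+-suc _ _)) (s≤s (admᵢⱼ refl refl)))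

  -- As `2 (n + 1) = 2 + 2 n`, one unit of dilation pays for exactly one low and one high layer.
  lattice-suc : ∀ U n → lattice U (suc n) ≡
    sumSplit _+_ U (λ A S → sumSplit _+_ S (λ B R → indicator (isolated? B R) * lattice R n))
  lattice-suc U n = trans
    (cong (λ m → sumBox U m (λ x → indicator (admissible? U m x))) (ℕₚ.*-suc 2 n))
    (trans (sumBox-peel U m (λ x → indicator (admissible? U (2 ℕ.+ m) x)))
      (sumSplit-cong U (λ A S s₁ → sumSplit-cong S (λ B R s₂ → trans
        (sumBox-cong R m (λ x b → trans
          (indicator-⇔ (Admissible-place s₁ s₂ m x b) (admissible? U (2 ℕ.+ m) (place B R (2 ℕ.+ m) x)) (isolated? B R ×-dec admissible? R m x))
          (indicator-× (isolated? B R) (admissible? R m x))))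
        (sumBox-* R m (indicator (isolated? B R)) _)))))
    where
    m : ℕ
    m = 2 ℕ.* n

  Isolated-⊥ : ∀ U → Isolated ⊥ U
  Isolated-⊥ U i j e p with () ← trans (sym (Vecₚ.lookup-replicate i false)) p

  -- `A ∪ R` and `D ∪ R′` are the same set, so only an edge from `C` back to `A` needs care: as `C`
  -- lies in `R`, it would contradict the isolation of `A`.
  Isolated-compose : ∀ {U A R C R′ D} → Split U A R → Split R C R′ → Split U D R′ → Split D A C →
    (Isolated A R × Isolated C R′) ⇔ Isolated D R′
  Isolated-compose {U} {A} {R} {C} {R′} {D} s₁ s₂ s₃ s₄ = mk⇔ to from
    where
    to : Isolated A R × Isolated C R′ → Isolated D R′
    to (isoA , isoC) i j e p
      with lookup D i | lookup A i | lookup C i | lookup R i | lookup R′ i | Split-lookup s₄ i | Split-lookup s₂ i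
         | isoA i j e | isoA j i (trans (symm G j i) e) | isoC i j e
    ... | _ | _ | _ | _ | _ | left | _ | h | _ | _
      with lookup A j | lookup R j | lookup C j | lookup R′ j | lookup D j | Split-lookup s₂ j | Split-lookup s₄ j | h refl
    ... | _ | _ | _ | _ | _ | out | out | refl , refl = refl , refl
    to (isoA , isoC) i j e p | _ | _ | _ | _ | _ | right | left | _ | h | k
      with lookup A j | lookup C j | lookup R′ j | lookup D j | Split-lookup s₄ j | k refl | h
    ... | _ | _ | _ | _ | out  | refl , refl | _ = refl , refl
    ... | _ | _ | _ | _ | left | refl , refl | h′ with () ← proj₂ (h′ refl)
    from : Isolated D R′ → Isolated A R × Isolated C R′
    from iso = isoA , isoC
      where
      isoA : Isolated A R
      isoA i j e p with lookup D i | lookup A i | lookup C i | Split-lookup s₄ i | iso i j e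
      ... | _ | _ | _ | left | h
        with lookup D j | lookup R′ j | lookup A j | lookup C j | lookup R j | Split-lookup s₄ j | Split-lookup s₂ j | h refl
      ... | _ | _ | _ | _ | _ | out | out | refl , refl = refl , refl
      isoC : Isolated C R′
      isoC i j e p with lookup D i | lookup A i | lookup C i | Split-lookup s₄ i | iso i j e
      ... | _ | _ | _ | right | h
        with lookup D j | lookup R′ j | lookup A j | lookup C j | Split-lookup s₄ j | h refl
      ... | _ | _ | _ | _ | out | refl , refl = refl , refl

  isolatedWeight : Weight d
  isolatedWeight .weight B R = constant (indicator (isolated? B R))
  isolatedWeight .unit U = Ring.reflexive (cong (λ b → constant (if b then 1ℤ else 0ℤ)) (dec-true (isolated? ⊥ U) (Isolated-⊥ U)))
  isolatedWeight .cone B R = indicator-Γ (isolated? B R)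
  isolatedWeight .compose {A = A} {R} {C} {R′} {D} s₁ s₂ s₃ s₄ = ≈-trans
    (solve 0 (con (indicator (isolated? A R)) :* con (indicator (isolated? C R′)) :=
      con (indicator (isolated? A R) * indicator (isolated? C R′))) ≈-refl)
    (Ring.reflexive (cong constant (trans (sym (indicator-× (isolated? A R) (isolated? C R′)))
      (indicator-⇔ (Isolated-compose s₁ s₂ s₃ s₄) (isolated? A R ×-dec isolated? C R′) (isolated? D R′)))))

  module Low  = Peel (freeWeight d)
  module High = Peel isolatedWeight

  -- Counts the points with no zero coordinate on `U`. At `n = 0` there is one only if `U` is empty,
  -- whence `ε`; otherwise removing the high layer lowers `n` by one, whence `t`.
  halfLattice : Family d
  halfLattice U = ε U ⊕ t ⊛ High.sum lattice U

  -- Points are sorted by their zero set, which may be any subset of `U`.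
  lattice-Low : ∀ U → lattice U ≈ Low.sum halfLattice U
  lattice-Low U = pointwise λ n → trans (at-n n) (sym (trans (∑-at U _ n)
      (sumSplit-cong U (λ A R _ → trans (⊛-identityˡ-at (𝟏 ⊛ halfLattice R) n) (⊛-identityˡ-at (halfLattice R) n)))))
    where
    at-n : ∀ n → lattice U n ≡ sumSplit _+_ U (λ A R → halfLattice R n)
    at-n zero    = trans (lattice-0 U) (sym (trans
      (sumSplit-cong U (λ A R _ → trans (cong (λ e → ε R 0 + e) (t-⊛-zero (High.sum lattice R))) (ℤₚ.+-identityʳ _)))
      (sumSplit-ε U)))
    at-n (suc n) = trans (lattice-suc U n) (sumSplit-cong U (λ A S _ → sym (begin
      ε S (suc n) + (t ⊛ High.sum lattice S) (suc n)
        ≡⟨ cong₂ _+_ (ε-suc S n) (t-⊛-suc (High.sum lattice S) n) ⟩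
      0ℤ + High.sum lattice S n
        ≡⟨ ℤₚ.+-identityˡ _ ⟩
      High.sum lattice S n
        ≡⟨ ∑-at S _ n ⟩
      sumSplit _+_ S (λ B R → (constant (indicator (isolated? B R)) ⊛ (𝟏 ⊛ lattice R)) n)
        ≡⟨ sumSplit-cong S (λ B R _ → trans (constant-⊛ (indicator (isolated? B R)) (𝟏 ⊛ lattice R) n)
             (cong (λ e → indicator (isolated? B R) * e) (⊛-identityˡ-at (lattice R) n))) ⟩
      sumSplit _+_ S (λ B R → indicator (isolated? B R) * lattice R n) ∎)))
      where open ≡-Reasoning

-- The numerator of the Ehrhart series

Split-self : ∀ {d} (U : Subset d) → Split U U ⊥
Split-self []          = []
Split-self (false ∷ U) = out (Split-self U)
Split-self (true ∷ U)  = left (Split-self U)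

nonempty : ∀ {d k} (U : Subset d) → size U ≡ suc k → ∃ λ i → lookup U i ≡ true
nonempty (true ∷ U)  e = zero , refl
nonempty (false ∷ U) e with i , p ← nonempty U e = suc i , p

u^-at-0 : ∀ n → (u ^ n) 0 ≡ 1ℤ
u^-at-0 zero    = refl
u^-at-0 (suc n) = cong (λ e → 1ℤ * e) (u^-at-0 n)

eulerian-at-0 : ∀ p → eulerian p 0 ≡ 1ℤ
eulerian-at-0 p = cong₂ _*_ (u^-at-0 (suc p)) (ℤₚ.^-zeroˡ p)

-- Pascal's rule. This identifies the alternating sum in `delta` with a product of series.
u^-at : ∀ n j → (u ^ n) j ≡ negPow j * + (n choose j)
u^-at zero    zero    = refl
u^-at zero    (suc j) = sym (trans (cong (λ e → negPow (suc j) * + e) (k>n⇒nCk≡0 {0} {suc j} (s≤s z≤n))) (ℤₚ.*-zeroʳ (negPow (suc j))))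
u^-at (suc n) zero    = u^-at-0 (suc n)
u^-at (suc n) (suc j) = begin
  (u ⊛ u ^ n) (suc j)
    ≡⟨ at (u-⊛ (u ^ n)) (suc j) ⟩
  (u ^ n) (suc j) + - (t ⊛ u ^ n) (suc j)
    ≡⟨ cong₂ (λ x y → x + - y) (u^-at n (suc j)) (trans (t-⊛-suc (u ^ n) j) (u^-at n j)) ⟩
  - negPow j * + (n choose suc j) + - (negPow j * + (n choose j))
    ≡⟨ lemma (negPow j) (+ (n choose j)) (+ (n choose suc j)) ⟩
  - negPow j * (+ (n choose j) + + (n choose suc j))
    ≡⟨ cong (λ e → - negPow j * + e) (nCk+nC[k+1]≡[n+1]C[k+1] n j) ⟩
  - negPow j * + (suc n choose suc j) ∎
  where
  open ≡-Reasoning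
  lemma : ∀ a x y → - a * y + - (a * x) ≡ - a * (x + y)
  lemma = solve-∀

sumTo-⊛ : ∀ f g k → sumTo (λ j → f j * g (k ∸ j)) k ≡ (f ⊛ g) k
sumTo-⊛ f g zero    = refl
sumTo-⊛ f g (suc k) = trans (sumTo-head (λ j → f j * g (suc k ∸ j)) k)
  (cong (λ e → f 0 * g (suc k) + e) (sumTo-⊛ (tail f) g k))

u^-⊛-ε : ∀ {d} (U : Subset d) → u ^ size U ⊛ ε U ≈ ε U
u^-⊛-ε U with size U
... | zero  = ⊛-identityˡ 𝟏
... | suc k = Ring.zeroʳ (u ^ suc k)

module Numerator {d : ℕ} (G : SimpleGraph d) where
  open Peeling G public

  -- Numerators over (1 - t)^(|U|+1) of the counts of points whose outermost
  -- nonempty layer is low (X) or high (Y); both are 1 for U = ∅.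
  X Y : Family d
  X U = u ^ size U ⊛ (lattice U ⊕ ⊖ t ⊛ High.sum lattice U)
  Y U = u ^ size U ⊛ (halfLattice U ⊕ ⊖ t ⊛ Low.sum halfLattice U)

  P Q : Family d → Family d
  P = Low.peel eulerian⁺
  Q f U = t ⊛ High.peel eulerian⁺ f U

  -- By `lattice-Low`, `lattice - t High.sum lattice` is `ε` plus
  -- `Low.sum halfLattice - halfLattice`, and `Low.peel-eulerian-sum` turns this difference into one
  -- low run followed by `Y`.
  X≈ε⊕PY : ∀ U → X U ≈ ε U ⊕ P Y U
  X≈ε⊕PY U = begin
    v ⊛ (L ⊕ ⊖ t ⊛ s)
      ≈⟨ solve 5 (λ v l t s e → v :* (l :+ :- t :* s) := v :* e :+ v :* (l :+ :- (e :+ t :* s))) ≈-refl v L t s (ε U) ⟩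
    v ⊛ ε U ⊕ v ⊛ (L ⊕ ⊖ halfLattice U)
      ≈⟨ Ring.+-cong (u^-⊛-ε U) (Ring.*-congˡ (⊕-congʳ (⊖ halfLattice U) (lattice-Low U))) ⟩
    ε U ⊕ v ⊛ (Low.sum halfLattice U ⊕ ⊖ halfLattice U)
      ≈⟨ ⊕-congˡ (ε U) (Low.peel-eulerian-sum halfLattice U) ⟨
    ε U ⊕ P Y U ∎
    where
    open ≈-Reasoning
    v L s : Series
    v = u ^ size U
    L = lattice U
    s = High.sum lattice U

  -- Likewise `halfLattice - t lattice` is `ε` plus `t` times `High.sum lattice - lattice`; this is
  -- the source of the factor `t` of a high run.
  Y≈ε⊕QX : ∀ U → Y U ≈ ε U ⊕ Q X U
  Y≈ε⊕QX U = begin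
    v ⊛ (ε U ⊕ t ⊛ s ⊕ ⊖ t ⊛ Low.sum halfLattice U)
      ≈⟨ Ring.*-congˡ (⊕-congˡ (ε U ⊕ t ⊛ s) (Ring.*-congˡ (lattice-Low U))) ⟨
    v ⊛ (ε U ⊕ t ⊛ s ⊕ ⊖ t ⊛ L)
      ≈⟨ solve 5 (λ v l t s e → v :* (e :+ t :* s :+ :- t :* l) := v :* e :+ t :* (v :* (s :+ :- l))) ≈-refl v L t s (ε U) ⟩
    v ⊛ ε U ⊕ t ⊛ (v ⊛ (s ⊕ ⊖ L))
      ≈⟨ Ring.+-cong (u^-⊛-ε U) (Ring.*-congˡ (≈-sym (High.peel-eulerian-sum lattice U))) ⟩
    ε U ⊕ Q X U ∎
    where
    open ≈-Reasoning
    v L s : Series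
    v = u ^ size U
    L = lattice U
    s = High.sum lattice U

  -- `(1 - t) L = (L - t s) + t (s - L)` with `s = High.sum lattice`: the first run is low or absent
  -- in `X`, and high in `Q X`.
  u^-⊛-lattice : ∀ U → u ^ suc (size U) ⊛ lattice U ≈ X U ⊕ Q X U
  u^-⊛-lattice U = begin
    u ⊛ v ⊛ L
      ≈⟨ solve 4 (λ v l t w → (con 1ℤ :+ :- t) :* v :* l :=
           v :* (l :+ :- t :* w) :+ v :* (t :* w :+ :- t :* l)) ≈-refl v L t s ⟩
    X U ⊕ v ⊛ (t ⊛ s ⊕ ⊖ t ⊛ L)
      ≈⟨ ⊕-congˡ (X U) (solve 4 (λ v l t s → v :* (t :* s :+ :- t :* l) := t :* (v :* (s :+ :- l))) ≈-refl v L t s) ⟩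
    X U ⊕ t ⊛ (v ⊛ (s ⊕ ⊖ L))
      ≈⟨ ⊕-congˡ (X U) (Ring.*-congˡ (High.peel-eulerian-sum lattice U)) ⟨
    X U ⊕ Q X U ∎
    where
    open ≈-Reasoning
    v L s : Series
    v = u ^ size U
    L = lattice U
    s = High.sum lattice U

  delta≡ : ∀ k → delta G k ≡ (X ⊤ ⊕ Q X ⊤) k
  delta≡ k = begin
    sumTo (λ j → negPow j * + (suc d choose j) * + ehrhart G (k ∸ j)) k
      ≡⟨ sumTo-cong k (λ j _ → cong₂ _*_ (sym (u^-at (suc d) j)) (ehrhart≡lattice (k ∸ j))) ⟩
    sumTo (λ j → (u ^ suc d) j * lattice ⊤ (k ∸ j)) k
      ≡⟨ sumTo-⊛ (u ^ suc d) (lattice ⊤) k ⟩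
    (u ^ suc d ⊛ lattice ⊤) k
      ≡⟨ cong (λ n → (u ^ suc n ⊛ lattice ⊤) k) (sym (Subsetₚ.∣⊤∣≡n d)) ⟩
    (u ^ suc (size {d} ⊤) ⊛ lattice ⊤) k
      ≡⟨ at (u^-⊛-lattice ⊤) k ⟩
    (X ⊤ ⊕ Q X ⊤) k ∎
    where open ≡-Reasoning

  -- A vertex of a nonempty first high layer would have all its neighbours outside `A ∪ R = ⊤`, yet
  -- it has a neighbour; so every nonempty layer has weight 0.
  Q-⊤ : NoIsolated G → ∀ f → Q f ⊤ ≈ 𝟎
  Q-⊤ noIso f = ≈-trans (Ring.*-congˡ (≈-trans (∑-cong ⊤ (λ A R s → term A R s (size A) refl)) (∑-𝟎 {d} ⊤))) (Ring.zeroʳ t)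
    where
    term : ∀ A R → Split ⊤ A R → ∀ k → size A ≡ k →
      constant (indicator (isolated? A R)) ⊛ (eulerian⁺ k ⊛ f R) ≈ 𝟎
    term A R s zero    _ = ≈-trans (Ring.*-congˡ (Ring.zeroˡ (f R))) (Ring.zeroʳ _)
    term A R s (suc k) e = ≈-trans (Ring.*-congʳ {eulerian (suc k) ⊛ f R} (Ring.reflexive (cong (λ b → constant (if b then 1ℤ else 0ℤ))
      (dec-false (isolated? A R) notIsolated)))) (Ring.zeroˡ (eulerian (suc k) ⊛ f R))
      where
      notIsolated : ¬ Isolated A R
      notIsolated iso with i , p ← nonempty A e with j , q ← noIso i
        with lookup ⊤ j | Vecₚ.lookup-replicate {n = d} j true | lookup A j | lookup R j | Split-lookup s j | iso i j q p
      ... | _ | refl | _ | _ | left  | () , _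
      ... | _ | refl | _ | _ | right | _ , ()

  P-vanishes : ∀ f U → (∀ R → size R < size U → f R ≈ 𝟎) → P f U ≈ 𝟎
  P-vanishes = Low.peel-eulerian-vanishes

  Q-vanishes : ∀ f U → (∀ R → size R < size U → f R ≈ 𝟎) → Q f U ≈ 𝟎
  Q-vanishes f U p = ≈-trans (Ring.*-congˡ (High.peel-eulerian-vanishes f U p)) (Ring.zeroʳ t)

  P-cong : ∀ {f g : Family d} → (∀ U → f U ≈ g U) → ∀ U → P f U ≈ P g U
  P-cong p U = Low.peel-cong eulerian⁺ U (λ _ R _ → p R)

  Q-cong : ∀ {f g : Family d} → (∀ U → f U ≈ g U) → ∀ U → Q f U ≈ Q g U
  Q-cong p U = Ring.*-congˡ (High.peel-cong eulerian⁺ U (λ _ R _ → p R))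

  P-⊕ : ∀ f g U → P (λ R → f R ⊕ g R) U ≈ P f U ⊕ P g U
  P-⊕ = Low.peel-⊕ eulerian⁺

  Q-⊕ : ∀ f g U → Q (λ R → f R ⊕ g R) U ≈ Q f U ⊕ Q g U
  Q-⊕ f g U = ≈-trans (Ring.*-congˡ (High.peel-⊕ eulerian⁺ f g U)) (Ring.distribˡ t _ _)

  PQ-⊕ : ∀ f g U → P (Q (λ R → f R ⊕ g R)) U ≈ P (Q f) U ⊕ P (Q g) U
  PQ-⊕ f g U = ≈-trans (P-cong (Q-⊕ f g) U) (P-⊕ (Q f) (Q g) U)

  -- Unfolding X = ε + P Y, Y = ε + Q X: the part a collects the layer sequences
  -- ending with a low run, c those ending with a high run.
  a c remainder : ℕ → Family d
  a zero    U = 𝟎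
  a (suc k) U = P ε U ⊕ P (Q (a k)) U
  c zero    U = 𝟎
  c (suc k) U = ε U ⊕ P (Q (c k)) U
  remainder zero    = X
  remainder (suc k) = P (Q (remainder k))

  X-unfold : ∀ U → X U ≈ ε U ⊕ (P ε U ⊕ P (Q X) U)
  X-unfold U = ≈-trans (X≈ε⊕PY U) (⊕-congˡ (ε U) (≈-trans (P-cong Y≈ε⊕QX U) (P-⊕ ε (Q X) U)))

  X≈ : ∀ k U → X U ≈ (a k U ⊕ c k U) ⊕ remainder k U
  X≈ zero    U = solve 1 (λ x → x := (con 0ℤ :+ con 0ℤ) :+ x) ≈-refl (X U)
  X≈ (suc k) U = begin
    X U
      ≈⟨ X-unfold U ⟩
    ε U ⊕ (P ε U ⊕ P (Q X) U)
      ≈⟨ ⊕-congˡ (ε U) (⊕-congˡ (P ε U) (≈-trans (P-cong (Q-cong (X≈ k)) U)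
           (≈-trans (PQ-⊕ (λ R → a k R ⊕ c k R) (remainder k) U) (⊕-congʳ (remainder (suc k) U) (PQ-⊕ (a k) (c k) U))))) ⟩
    ε U ⊕ (P ε U ⊕ (P (Q (a k)) U ⊕ P (Q (c k)) U ⊕ remainder (suc k) U))
      ≈⟨ solve 5 (λ e p a c r → e :+ (p :+ (a :+ c :+ r)) := (p :+ a :+ (e :+ c)) :+ r)
           ≈-refl (ε U) (P ε U) (P (Q (a k)) U) (P (Q (c k)) U) (remainder (suc k) U) ⟩
    (a (suc k) U ⊕ c (suc k) U) ⊕ remainder (suc k) U ∎
    where open ≈-Reasoning

  -- Each round of `P` and `Q` removes two nonempty layers, so the vertices run out before the
  -- rounds do.
  remainder-vanishes : ∀ k U → size U < k → remainder k U ≈ 𝟎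
  remainder-vanishes (suc k) U (s≤s lt) = P-vanishes (Q (remainder k)) U λ R R<U →
    Q-vanishes (remainder k) R λ R′ R′<R →
      remainder-vanishes k R′ (ℕₚ.<-≤-trans (ℕₚ.<-trans R′<R R<U) lt)

  -- A low run on `p` vertices has degree `p - 1`, which lowers the excess of the index over the
  -- number of vertices by one. With offset 1, index `s` stands for degree `s - 1`.
  P-Γ : ∀ (f : Family d) n U → (∀ R → Γ 1 (size R ℕ.+ suc n) (f R)) → Γ 1 (size U ℕ.+ n) (P f U)
  P-Γ f n U p = Low.peel-Γ f (suc n) U p (λ m e → trans (ℕₚ.+-suc m n) (cong (ℕ._+ n) (sym e)))

  -- The factor `t` adds two to the index and the run loses one, so the excess rises by one; hence
  -- `P` after `Q` preserves it.
  Q-Γ : ∀ (f : Family d) n U → (∀ R → Γ 1 (size R ℕ.+ n) (f R)) → Γ 1 (size U ℕ.+ suc n) (Q f U)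
  Q-Γ f n U p with size U in e
  -- An empty `U` has no nonempty layer, so the value is zero.
  ... | zero  = resp (≈-sym (Q-vanishes f U (λ R lt → ⊥-elim (ℕₚ.n≮0 (subst (size R <_) e lt))))) nil
  ... | suc m = subst (λ s → Γ 1 s (Q f U)) (cong suc (sym (ℕₚ.+-suc m n)))
    (t· (High.peel-Γ f n U p (λ k e′ → cong (ℕ._+ n) (ℕₚ.suc-injective (trans (sym e′) e)))))

  ε-Γ : ∀ U → Γ 1 (size U ℕ.+ 1) (ε {d} U)
  ε-Γ U with size U
  ... | zero  = one
  ... | suc _ = nil

  -- Ending with a low run means starting the recursion from `P ε`, of excess 0. The centre of
  -- symmetry is `(size U - 1) / 2`.
  a-Γ : ∀ k U → Γ 1 (size U ℕ.+ 0) (a k U)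
  a-Γ zero    U = nil
  a-Γ (suc k) U = add (P-Γ ε 0 U ε-Γ) (P-Γ (Q (a k)) 0 U (λ R → Q-Γ (a k) 0 R (a-Γ k)))

  -- Here the recursion starts from `ε`, of excess 1, which puts the centre at `size U / 2`.
  c-Γ : ∀ k U → Γ 1 (size U ℕ.+ 1) (c k U)
  c-Γ zero    U = nil
  c-Γ (suc k) U = add (ε-Γ U) (P-Γ (Q (c k)) 1 U (λ R → Q-Γ (c k) 1 R (c-Γ k)))

  PQ-at-0 : ∀ (f : Family d) U → P (Q f) U 0 ≡ 0ℤ
  PQ-at-0 f U = trans (∑-at U _ 0) (sumSplit-induction (_≡ 0ℤ) (cong₂ _+_) U
    (λ A R _ → trans (cong (λ e → 1ℤ * (eulerian⁺ (size A) 0 * e)) (t-⊛-zero (High.peel eulerian⁺ f R)))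
                     (cong (λ e → 1ℤ * e) (ℤₚ.*-zeroʳ (eulerian⁺ (size A) 0)))))

  c-⊥ : ∀ k → c (suc k) ⊥ 0 ≡ 1ℤ
  c-⊥ k = cong₂ _+_ (cong (λ n → ifEmpty n 0) (Subsetₚ.∣⊥∣≡0 d)) (PQ-at-0 (c k) ⊥)

c-⊤-at-0 : ∀ {d} (G : SimpleGraph (suc d)) k → Numerator.c G k ⊤ 0 ≡ 0ℤ
c-⊤-at-0 G zero    = refl
c-⊤-at-0 G (suc k) = cong (λ e → 0ℤ + e) (Numerator.PQ-at-0 G (Numerator.c G k) ⊤)

-- One sequence already contributes: a low run on all vertices but `zero`, then a high run on `zero`
-- alone. One unfolding of `c` gives the two runs, a second the final `ε`. This makes the degree of
-- `b` exact.
c-⊤-at-1 : ∀ {e} (G : SimpleGraph (suc (suc e))) k → 1ℤ ℤ.≤ Numerator.c G (suc (suc k)) ⊤ 1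
c-⊤-at-1 {e} G k = begin
  1ℤ
    ≡⟨ sym (cong₂ _*_ weight≡1 (cong₂ _*_ (eulerian-at-0 (suc (size {suc e} ⊥))) (c-⊥ k))) ⟩
  (isolatedWeight .weight vertex ⊥ ⊛ (eulerian⁺ (size vertex) ⊛ c (suc k) ⊥)) 0
    ≤⟨ High.peel-≥ (c (suc k)) 1 0 (c-Γ (suc k)) (Split-self vertex) ⟩
  High.peel eulerian⁺ (c (suc k)) vertex 0
    ≡⟨ sym (t-⊛-suc (High.peel eulerian⁺ (c (suc k)) vertex) 0) ⟩
  g 1
    ≡⟨ sym first-order ⟩
  (𝟏 ⊛ (eulerian⁺ (size others) ⊛ g)) 1
    ≤⟨ Low.peel-≥ (Q (c (suc k))) 2 1 (λ R → Q-Γ (c (suc k)) 1 R (c-Γ (suc k))) (right (Split-self ⊤)) ⟩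
  P (Q (c (suc k))) ⊤ 1
    ≡⟨ sym (ℤₚ.+-identityˡ _) ⟩
  c (suc (suc k)) ⊤ 1 ∎
  where
  open ℤₚ.≤-Reasoning
  open Numerator G
  vertex others : Subset (suc (suc e))
  vertex = true ∷ ⊥
  others = false ∷ ⊤
  g : Series
  g = Q (c (suc k)) vertex
  isolated : Isolated vertex ⊥
  isolated zero zero    ij _ with () ← trans (sym (irrefl G zero)) ij
  isolated zero (suc j) _  _ = Vecₚ.lookup-replicate j false , Vecₚ.lookup-replicate (suc j) false
  isolated (suc i) _ _ p with () ← trans (sym (Vecₚ.lookup-replicate i false)) p
  weight≡1 : indicator (isolated? vertex ⊥) ≡ 1ℤ
  weight≡1 = cong (if_then 1ℤ else 0ℤ) (dec-true (isolated? vertex ⊥) isolated)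
  -- `g` has no constant term, so only the constant coefficient 1 of the Eulerian factor enters.
  first-order : (𝟏 ⊛ (eulerian⁺ (size others) ⊛ g)) 1 ≡ g 1
  first-order = trans (⊛-identityˡ-at (eulerian⁺ (size others) ⊛ g) 1)
    (trans (cong₂ (λ x y → x * g 1 + eulerian⁺ (size others) 1 * y) (eulerian-at-0 (suc (size {e} ⊤)))
              (t-⊛-zero (High.peel eulerian⁺ (c (suc k)) vertex)))
           (lemma (g 1) (eulerian⁺ (size others) 1)))
    where
    lemma : ∀ x y → 1ℤ * x + y * 0ℤ ≡ x
    lemma = solve-∀

-- Unimodality, the two summands and the alternating inequalities

Symmetric⇒Unimodal : ∀ f m → Symmetric f m → (∀ i → suc (i ℕ.+ i) ≤ m → f i ℤ.≤ f (suc i)) → Unimodal f m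
-- Past the peak at `⌊ m /2⌋`, the step from `i` to `suc i` mirrors the ascending step at
-- `m ∸ suc i`.
Symmetric⇒Unimodal f m sy inc = ℕ.⌊ m /2⌋ , ℕₚ.⌊n/2⌋≤n m ,
  (λ i i<h → inc i (up i i<h)) , (λ i h≤i i<m → subst₂ ℤ._≤_
    (sym (sy (suc i) i<m))
    (trans (cong f (sym (ℕₚ.+-∸-assoc 1 i<m))) (sym (sy i (ℕₚ.<⇒≤ i<m))))
    (inc (m ∸ suc i) (down i h≤i i<m)))
  where
  open ℕₚ.≤-Reasoning
  up : ∀ i → i < ℕ.⌊ m /2⌋ → suc (i ℕ.+ i) ≤ m
  up i lt = begin
    suc i ℕ.+ i                   ≤⟨ ℕₚ.+-mono-≤ lt (ℕₚ.≤-trans (ℕₚ.<⇒≤ lt) (ℕₚ.⌊n/2⌋≤⌈n/2⌉ m)) ⟩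
    ℕ.⌊ m /2⌋ ℕ.+ ℕ.⌈ m /2⌉       ≡⟨ ℕₚ.⌊n/2⌋+⌈n/2⌉≡n m ⟩
    m                             ∎
  down : ∀ i → ℕ.⌊ m /2⌋ ≤ i → i < m → suc ((m ∸ suc i) ℕ.+ (m ∸ suc i)) ≤ m
  down i le lt = begin
    suc (m ∸ suc i) ℕ.+ (m ∸ suc i)  ≤⟨ ℕₚ.+-monoʳ-≤ (suc (m ∸ suc i)) bound ⟩
    suc (m ∸ suc i) ℕ.+ i            ≡⟨ cong suc (ℕₚ.+-comm (m ∸ suc i) i) ⟩
    suc i ℕ.+ (m ∸ suc i)            ≡⟨ ℕₚ.m+[n∸m]≡n lt ⟩
    m                                ∎
    where
    bound : m ∸ suc i ≤ i
    bound = begin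
      m ∸ suc i                          ≡⟨ cong (_∸ suc i) (sym (ℕₚ.⌊n/2⌋+⌈n/2⌉≡n m)) ⟩
      ℕ.⌊ m /2⌋ ℕ.+ ℕ.⌈ m /2⌉ ∸ suc i    ≤⟨ ℕₚ.∸-monoˡ-≤ (suc i) (ℕₚ.+-mono-≤ le (ℕₚ.≤-trans (ℕₚ.⌊n/2⌋-mono (ℕₚ.n≤1+n (suc m))) (s≤s le))) ⟩
      i ℕ.+ suc i ∸ suc i                ≡⟨ ℕₚ.m+n∸n≡m i (suc i) ⟩
      i                                  ∎

module Decomposition {e : ℕ} (G : SimpleGraph (suc (suc e))) (noIsolated : NoIsolated G) where
  open Numerator G using (X; Q; delta≡; Q-⊤; X≈; remainder-vanishes; a-Γ; c-Γ)

  private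
    d fuel : ℕ
    d = suc (suc e)
    -- One more than the number of vertices, so that the remainder vanishes on `⊤`.
    fuel = suc d

  a c b : Series
  a = Numerator.a G fuel ⊤
  c = Numerator.c G fuel ⊤
  b = tail c

  a∈Γ : Γ 1 d a
  a∈Γ = subst (λ s → Γ 1 s a) (trans (ℕₚ.+-identityʳ _) (Subsetₚ.∣⊤∣≡n d)) (a-Γ fuel ⊤)

  c∈Γ : Γ 1 (suc d) c
  c∈Γ = subst (λ s → Γ 1 s c) (trans (ℕₚ.+-comm (size {d} ⊤) 1) (cong suc (Subsetₚ.∣⊤∣≡n d))) (c-Γ fuel ⊤)

  c-at-0 : c 0 ≡ 0ℤ
  c-at-0 = c-⊤-at-0 G fuel

  delta≡a+c : ∀ k → delta G k ≡ a k + c k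
  delta≡a+c k = trans (delta≡ k) (at (begin
    X ⊤ ⊕ Q X ⊤                       ≈⟨ Ring.+-cong (X≈ fuel ⊤) (Q-⊤ noIsolated X) ⟩
    a ⊕ c ⊕ Numerator.remainder G fuel ⊤ ⊕ 𝟎  ≈⟨ ⊕-congʳ 𝟎 (⊕-congˡ (a ⊕ c) (remainder-vanishes fuel ⊤
                                           (ℕₚ.≤-reflexive (cong suc (Subsetₚ.∣⊤∣≡n d))))) ⟩
    a ⊕ c ⊕ 𝟎 ⊕ 𝟎                     ≈⟨ solve 2 (λ a c → a :+ c :+ con 0ℤ :+ con 0ℤ := a :+ c) ≈-refl a c ⟩
    a ⊕ c ∎) k)
    where open ≈-Reasoning

  -- Read off from δ_0 = L(0) = 1, as `c` has no constant term. By symmetry this is also the leading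
  -- coefficient of `a`.
  a-at-0 : a 0 ≡ 1ℤ
  a-at-0 = begin
    a 0                                  ≡⟨ sym (trans (cong (λ x → a 0 + x) c-at-0) (ℤₚ.+-identityʳ (a 0))) ⟩
    a 0 + c 0                            ≡⟨ delta≡a+c 0 ⟨
    1ℤ * + (suc d choose 0) * + ehrhart G 0   ≡⟨ cong (λ x → 1ℤ * 1ℤ * x) (trans (Numerator.ehrhart≡lattice G 0) (Numerator.lattice-0 G ⊤)) ⟩
    1ℤ ∎
    where open ≡-Reasoning

  a-sym : ∀ i j → i ℕ.+ j ≡ suc e → a i ≡ a j
  a-sym i j p = Γ-symmetric a∈Γ i j (trans (ℕₚ.+-comm (i ℕ.+ j) 1) (cong suc p))

  b-sym : ∀ i j → i ℕ.+ j ≡ e → b i ≡ b j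
  b-sym i j p = Γ-symmetric c∈Γ (suc i) (suc j)
    (trans (ℕₚ.+-comm (suc i ℕ.+ suc j) 1) (cong (λ k → suc (suc k)) (trans (ℕₚ.+-suc i j) (cong suc p))))

  a-inc : ∀ i → suc (i ℕ.+ i) ≤ suc e → a i ℤ.≤ a (suc i)
  a-inc i p = Γ-increasing a∈Γ i (s≤s (subst (_≤ suc e) (ℕₚ.+-comm 1 (i ℕ.+ i)) p))

  c-inc : ∀ i → suc (i ℕ.+ i) ≤ d → c i ℤ.≤ c (suc i)
  c-inc i p = Γ-increasing c∈Γ i (s≤s (subst (_≤ d) (ℕₚ.+-comm 1 (i ℕ.+ i)) p))

  a-degree : HasDegree a (suc e)
  a-degree = (λ z → 1≢0 (trans (sym a-at-0) (trans (a-sym 0 (suc e) refl) z)))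
           , (λ i p → Γ-vanish a∈Γ i (subst (d <_) (ℕₚ.+-comm 1 i) (s≤s p)))
    where
    1≢0 : ¬ 1ℤ ≡ 0ℤ
    1≢0 ()

  b-degree : HasDegree b e
  b-degree = (λ z → contra (subst (1ℤ ℤ.≤_) (trans (b-sym 0 e refl) z) (c-⊤-at-1 G (suc e))))
           , vanish
    where
    contra : ¬ (1ℤ ℤ.≤ 0ℤ)
    contra (ℤ.+≤+ ())
    vanish : ∀ i → e < i → b i ≡ 0ℤ
    vanish i p with ℕₚ.m≤n⇒m<n∨m≡n p
    ... | inj₁ lt   = Γ-vanish c∈Γ (suc i) (subst (suc d <_) (ℕₚ.+-comm 1 (suc i)) (s≤s (s≤s lt)))
    -- The cone alone bounds the degree of `c` by `d`; symmetry mirrors `c d` to `c 0`, which is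
    -- zero.
    ... | inj₂ refl = trans (Γ-symmetric c∈Γ d 0 (trans (cong (ℕ._+ 1) (ℕₚ.+-identityʳ d)) (ℕₚ.+-comm d 1))) c-at-0

  a-symmetric : Symmetric a (suc e)
  a-symmetric i p = a-sym i (suc e ∸ i) (ℕₚ.m+[n∸m]≡n p)

  b-symmetric : Symmetric b e
  b-symmetric i p = b-sym i (e ∸ i) (ℕₚ.m+[n∸m]≡n p)

  b-inc : ∀ i → suc (i ℕ.+ i) ≤ e → b i ℤ.≤ b (suc i)
  b-inc i p = c-inc (suc i) (s≤s (subst (_≤ suc e) (cong suc (sym (ℕₚ.+-suc i i))) (s≤s p)))

  delta≡a+tb : ∀ k → delta G k ≡ a k + timesT b k
  delta≡a+tb zero    = trans (delta≡a+c 0) (cong (λ x → a 0 + x) c-at-0)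
  delta≡a+tb (suc k) = delta≡a+c (suc k)

  -- As `a` has centre `(d - 1) / 2` and `c` has centre `d / 2`, the mirrored entry is
  -- `a i + c (suc i)`. It differs from each of its two neighbours in the chain in one summand only.
  alternating : AltIncreasing (delta G) d
  alternating i i<d/2 =
    (begin
      delta G i              ≡⟨ delta≡a+c i ⟩
      a i + c i              ≤⟨ ℤₚ.+-monoʳ-≤ (a i) (c-inc i (ℕₚ.≤-trans (ℕₚ.n≤1+n _) 2i+2≤d)) ⟩
      a i + c (suc i)        ≡⟨ mirror ⟨
      delta G (suc e ∸ i)    ∎) ,
    (begin
      delta G (suc e ∸ i)    ≡⟨ mirror ⟩
      a i + c (suc i)        ≤⟨ ℤₚ.+-monoˡ-≤ (c (suc i)) (a-inc i (ℕₚ.≤-pred 2i+2≤d)) ⟩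
      a (suc i) + c (suc i)  ≡⟨ delta≡a+c (suc i) ⟨
      delta G (suc i)        ∎)
    where
    open ℤₚ.≤-Reasoning
    2i+2≤d : suc (suc (i ℕ.+ i)) ≤ d
    2i+2≤d = ℕₚ.≤-trans (ℕₚ.≤-reflexive (trans (cong suc (sym (ℕₚ.+-suc i i)))
      (trans (cong (λ k → suc (i ℕ.+ suc k)) (sym (ℕₚ.+-identityʳ i))) (ℕₚ.*-comm 2 (suc i)))))
      (ℕₚ.≤-trans (ℕₚ.*-monoˡ-≤ 2 i<d/2) (m/n*n≤m d 2))
    i≤ : i ≤ suc e
    i≤ = ℕₚ.≤-trans (ℕₚ.m≤m+n i i) (ℕₚ.≤-trans (ℕₚ.n≤1+n _) (ℕₚ.≤-pred 2i+2≤d))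
    mirror : delta G (suc e ∸ i) ≡ a i + c (suc i)
    mirror = trans (delta≡a+c (suc e ∸ i)) (cong₂ _+_ (sym (a-symmetric i i≤))
      (Γ-symmetric c∈Γ (suc e ∸ i) (suc i) (trans (cong (ℕ._+ 1) (trans (ℕₚ.+-suc (suc e ∸ i) i)
        (cong suc (ℕₚ.m∸n+n≡m i≤)))) (ℕₚ.+-comm d 1))))

theorem1p2 : (d : ℕ) → 1 ≤ d → (G : SimpleGraph d) → NoIsolated G →
    Σ (ℕ → ℤ) (λ a → Σ (ℕ → ℤ) (λ b →
    (HasDegree a (d ∸ 1) × Symmetric a (d ∸ 1) × Unimodal a (d ∸ 1)) ×
    (HasDegree b (d ∸ 2) × Symmetric b (d ∸ 2) × Unimodal b (d ∸ 2)) ×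
    (∀ k → delta G k ≡ a k + timesT b k)))
    × AltIncreasing (delta G) d
-- For `d = 1` the neighbour could only be the vertex itself, which irreflexivity excludes.
theorem1p2 (suc zero) _ G noIsolated with zero , p ← noIsolated zero
  with () ← trans (sym (irrefl G zero)) p
theorem1p2 (suc (suc e)) _ G noIsolated =
  (a , b , (a-degree , a-symmetric , Symmetric⇒Unimodal a (suc e) a-symmetric a-inc)
         , (b-degree , b-symmetric , Symmetric⇒Unimodal b e b-symmetric b-inc)
         , delta≡a+tb)
  , alternating
  where open Decomposition G noIsolated
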